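{- Let $E$ be the following set of 177 nonnegative integers: $E=\{0, 2, 4, 7, 8, 11, 16, 17, 29, 92, 125, 154, 155, 174, 361, 390, 441, 473, 529, 564, 601, 637, 704, 742, 743, 783, 837, 1003, 1147, 1184, 1340, 1341, 1380, 1394, 1548, 1549, 1606, 1665, 1771, 1772, 1833, 1896, 2173, 2241, 2279, 2508, 2581, 2867, 2945, 3250, 3333, 3336, 3503, 3588, 3657, 3745, 3748, 3925, 4015, 4016, 4107, 4466, 4467, 4563, 4564, 4661, 5186, 5289, 5806, 5915, 6026, 6461, 6576, 6693, 6811, 7151, 7272, 7395, 7396, 7436, 7519, 8003, 8132, 8133, 8262, 8305, 9222, 9454, 10086, 10187, 10478, 11200, 11245, 11505, 12261, 12467, 12580, 12583, 12904, 13066, 13370, 13703, 13752, 14041, 14210, 14381, 15052, 15227, 15402, 15403, 15580, 15759, 16511, 17254, 17441, 17985, 18955, 19152, 19522, 20532, 20533, 20737, 21122, 21961, 22172, 22173, 22385, 22654, 22814, 23656, 23875, 23876, 24096, 24541, 24598, 26855, 28726, 28783, 28968, 30910, 31161, 33174, 33434, 35518, 35787, 36391, 37147, 39125, 39625, 39626, 39909, 41958, 44890, 47921, 50126, 51051, 53326, 53327, 53655, 56625, 56626, 56964, 61851, 65764, 66129, 69797, 70173, 73950, 74337, 78223, 78621, 108375, 114014, 129359, 136036, 142881, 149894\}$. Then for every integer $n \geq 0$ with $n \notin E$ (in particular, for every $n > 149{,}894$) we have \[ P(n) = f(n) + Q(g(n)) \qquad\text{and}\qquad Q(n) = 1 +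 f(n) + P(g(n)). \] Moreover, $f(n)$ and $g(n)$ are the smallest nonnegative integers satisfying $[1+2+\cdots+f(n)] - g(n) = n$.
   Context: For $A \subseteq \{0,1,2,\ldots\}$, the boundary of $A$ is $\partial A = \{z \in A : \{z-1,z+1\} \not\subseteq A\}$, the volume is $vol(A)=\sum_{z\in A} z$ and the perimeter is $per(A) = \sum_{z \in \partial A} z$ (both are $0$ for the empty set). The complement is $A^c = \{0,1,2,\ldots\}\setminus A$. For an integer $n\ge 0$, $P(n) = \min\{per(A) : A \subseteq \{0,1,\ldots\},\ vol(A)=n\}$ and $Q(n) = \min\{per(A^c) : A \subseteq \{0,1,\ldots\},\ vol(A) = n\}$. Define $f(n) = \lfloor \sqrt{2n} + 1/2\rfloor$ (the nearest integer to $\sqrt{2n}$) and $g(n) = f(n)(f(n)+1)/2 - n$. -}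

module Defs where

open import Data.Nat using (ℕ; zero; suc; _+_; _*_; _∸_; _≤_; _≤ᵇ_; _/_)
open import Data.Bool using (Bool; true; false; if_then_else_; _∧_; not)
open import Data.List using (List; []; _∷_)
open import Data.Product using (Σ; _×_; _,_)
open import Relation.Binary.PropositionalEquality using (_≡_)

sumBelow : ℕ → (ℕ → ℕ) → ℕ
sumBelow zero    h = 0
sumBelow (suc b) h = sumBelow b h + h b

ind : Bool → ℕ
ind true  = 1
ind false = 0

-- A subset of ℕ = {0,1,2,...} given by a characteristic function.
-- Left neighbour membership: is z-1 in S?  (z-1 = -1 is never in S ⊆ ℕ.)
leftIn : (ℕ → Bool) → ℕ → Bool
leftIn S zero    = false
leftIn S (suc z) = S z

inBoundary : (ℕ → Bool) → ℕ → Bool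
inBoundary S z = S z ∧ not (leftIn S z ∧ S (suc z))

compl : (ℕ → Bool) → (ℕ → Bool)
compl S z = not (S z)

-- A finite subset of ℕ: characteristic function with a strict upper bound
-- for its elements.  (A set with finite volume vol(A) is finite, since only 0
-- contributes 0; volume is only defined for such sets.)
record FinSub : Set where
  constructor finSub
  field
    mem     : ℕ → Bool
    bound   : ℕ
    bounded : ∀ z → bound ≤ z → mem z ≡ false
open FinSub public

vol : FinSub → ℕ
vol A = sumBelow (bound A) (λ z → z * ind (mem A z))

-- per(A) = Σ_{z ∈ ∂A} z   (∂A ⊆ A ⊆ [0, bound))
per : FinSub → ℕ
per A = sumBelow (bound A) (λ z → z * ind (inBoundary (mem A) z))

-- per(A^c) = Σ_{z ∈ ∂(A^c)} z.  Every z > bound A has z-1, z+1 ∈ A^c, so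
-- ∂(A^c) ⊆ [0, bound A]; summing over z < bound A + 1 is exact.
perCompl : FinSub → ℕ
perCompl A = sumBelow (suc (bound A)) (λ z → z * ind (inBoundary (compl (mem A)) z))

IsP : ℕ → ℕ → Set
IsP n m = Σ FinSub (λ A → vol A ≡ n × per A ≡ m)
        × (∀ (A : FinSub) → vol A ≡ n → m ≤ per A)

IsQ : ℕ → ℕ → Set
IsQ n m = Σ FinSub (λ A → vol A ≡ n × perCompl A ≡ m)
        × (∀ (A : FinSub) → vol A ≡ n → m ≤ perCompl A)

isqrt : ℕ → ℕ
isqrt zero    = 0
isqrt (suc m) = if (suc r * suc r) ≤ᵇ suc m then suc r else r
  where r = isqrt m

-- f(n) = ⌊√(2n) + 1/2⌋ = ⌊(√(8n) + 1)/2⌋ = ⌊(⌊√(8n)⌋ + 1)/2⌋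
f : ℕ → ℕ
f n = (isqrt (8 * n) + 1) / 2

tri : ℕ → ℕ
tri k = (k * (k + 1)) / 2

g : ℕ → ℕ
g n = tri (f n) ∸ n

E : List ℕ
E = 0 ∷ 2 ∷ 4 ∷ 7 ∷ 8 ∷ 11 ∷ 16 ∷ 17 ∷ 29 ∷ 92 ∷ 125 ∷ 154 ∷ 155 ∷ 174 ∷ 361 ∷ 390 ∷ 441 ∷ 473 ∷ 529 ∷ 564 ∷ 601 ∷ 637 ∷ 704 ∷ 742 ∷ 743 ∷ 783 ∷ 837 ∷ 1003 ∷ 1147 ∷ 1184 ∷ 1340 ∷ 1341 ∷ 1380 ∷ 1394 ∷ 1548 ∷ 1549 ∷ 1606 ∷ 1665 ∷ 1771 ∷ 1772 ∷ 1833 ∷ 1896 ∷ 2173 ∷ 2241 ∷ 2279 ∷ 2508 ∷ 2581 ∷ 2867 ∷ 2945 ∷ 3250 ∷ 3333 ∷ 3336 ∷ 3503 ∷ 3588 ∷ 3657 ∷ 3745 ∷ 3748 ∷ 3925 ∷ 4015 ∷ 4016 ∷ 4107 ∷ 4466 ∷ 4467 ∷ 4563 ∷ 4564 ∷ 4661 ∷ 5186 ∷ 5289 ∷ 5806 ∷ 5915 ∷ 6026 ∷ 6461 ∷ 6576 ∷ 6693 ∷ 6811 ∷ 7151 ∷ 7272 ∷ 7395 ∷ 7396 ∷ 7436 ∷ 7519 ∷ 8003 ∷ 8132 ∷ 8133 ∷ 8262 ∷ 8305 ∷ 9222 ∷ 9454 ∷ 10086 ∷ 10187 ∷ 10478 ∷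 11200 ∷ 11245 ∷ 11505 ∷ 12261 ∷ 12467 ∷ 12580 ∷ 12583 ∷ 12904 ∷ 13066 ∷ 13370 ∷ 13703 ∷ 13752 ∷ 14041 ∷ 14210 ∷ 14381 ∷ 15052 ∷ 15227 ∷ 15402 ∷ 15403 ∷ 15580 ∷ 15759 ∷ 16511 ∷ 17254 ∷ 17441 ∷ 17985 ∷ 18955 ∷ 19152 ∷ 19522 ∷ 20532 ∷ 20533 ∷ 20737 ∷ 21122 ∷ 21961 ∷ 22172 ∷ 22173 ∷ 22385 ∷ 22654 ∷ 22814 ∷ 23656 ∷ 23875 ∷ 23876 ∷ 24096 ∷ 24541 ∷ 24598 ∷ 26855 ∷ 28726 ∷ 28783 ∷ 28968 ∷ 30910 ∷ 31161 ∷ 33174 ∷ 33434 ∷ 35518 ∷ 35787 ∷ 36391 ∷ 37147 ∷ 39125 ∷ 39625 ∷ 39626 ∷ 39909 ∷ 41958 ∷ 44890 ∷ 47921 ∷ 50126 ∷ 51051 ∷ 53326 ∷ 53327 ∷ 53655 ∷ 56625 ∷ 56626 ∷ 56964 ∷ 61851 ∷ 65764 ∷ 66129 ∷ 69797 ∷ 70173 ∷ 73950 ∷ 74337 ∷ 78223 ∷ 78621 ∷ 108375 ∷ 114014 ∷ 129359 ∷ 136036 ∷ 142881 ∷ 149894 ∷ []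

-- Let A have maximum m and let B = {0..m} ∖ A. Then vol A + vol B = tri m and
-- per(Aᶜ) = m + 1 + per B, while per A = m + per(Bᶜ) unless m is isolated in A. So, with
-- F = f n, G = g n and n + x = tri (F + j), the recursions hold as soon as P G ≤ j + P x and
-- Q G ≤ j + Q x for all j (m = F + j costs j more than m = F), together with a similar
-- inequality for isolated m. Since f x ≤ P x, Q x while P y, Q y ≤ 8 + y/4, this is automatic
-- for G ≥ 1226. For smaller G it is checked against a table of P and Q below 1226, which also
-- settles every F because x grows with F; the pairs (F , G) that fail are those with n ∈ E.
-- The table is certified from above by explicit sets and the recursion, and from below by
-- induction on the maximum.

module Submission where

open import Defs
open import Algebra.Properties.CommutativeSemigroup using (interchange)
open import Data.Bool using (Bool; true; false; if_then_else_; _∧_; _∨_; not; T)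
open import Data.Bool.ListAction using (any)
open import Data.Bool.Properties using (T-≡; T-∧; T-∨; ∧-zeroʳ; not-involutive)
open import Data.Empty using (⊥-elim)
open import Data.List using (List; []; _∷_; _++_; filter; length; map; reverse; take)
open import Data.List.Extrema.Nat using (argmin; argmin-all; f[argmin]≤v⁺)
open import Data.List.Membership.Propositional using (_∈_; lose)
open import Data.List.Membership.Propositional.Properties using (∈-++⁺ˡ; ∈-++⁺ʳ; ∈-map⁺; ∈-filter⁺; ∈-filter⁻)
open import Data.List.Relation.Unary.All using (tabulate)
open import Data.List.Relation.Unary.Any as Any using (here; satisfied)
open import Data.List.Relation.Unary.Any.Properties using (any⁻)
open import Data.Nat using (ℕ; zero; suc; _+_; _*_; _∸_; _⊔_; _/_; _%_; _≤ᵇ_; _<ᵇ_; _≡ᵇ_; _≤_; _<_; z≤n; s≤s; s≤s⁻¹; _≤?_; _<?_; _≟_)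
open import Data.Nat.Divisibility using (divides-refl)
open import Data.Nat.DivMod using (+-distrib-/-∣ʳ; m*n/n≡m; /-monoˡ-≤; m≡m%n+[m/n]*n; m%n<n; m<n*o⇒m/o<n)
open import Data.Nat.Induction using (<-rec)
open import Data.Nat.Properties
open import Data.Nat.Tactic.RingSolver using (solve-∀)
open import Data.Product using (Σ; _×_; _,_; proj₁; proj₂)
open import Data.Sum as Sum using (_⊎_; inj₁; inj₂; [_,_]′)
open import Function using (_∘_; Equivalence)
open import Relation.Nullary using (¬_; yes; no)
open import Relation.Binary.PropositionalEquality

-- Finite sums and triangular numbers.

sum-cong : ∀ b {h k : ℕ → ℕ} → (∀ z → z < b → h z ≡ k z) → sumBelow b h ≡ sumBelow b k
sum-cong zero    h≗k = refl
sum-cong (suc b) h≗k = cong₂ _+_ (sum-cong b λ z z<b → h≗k z (m<n⇒m<1+n z<b)) (h≗k b ≤-refl)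

sum-extend : ∀ {b} c {h : ℕ → ℕ} → b ≤ c → (∀ z → b ≤ z → h z ≡ 0) → sumBelow c h ≡ sumBelow b h
sum-extend {b} c b≤c h≡0 with m≤n⇒m<n∨m≡n b≤c
sum-extend {b} c b≤c h≡0 | inj₂ refl = refl
sum-extend {b} (suc c) {h} b≤c h≡0 | inj₁ (s≤s b≤c′) = begin
  sumBelow c h + h c ≡⟨ cong₂ _+_ (sum-extend c b≤c′ h≡0) (h≡0 c b≤c′) ⟩
  sumBelow b h + 0   ≡⟨ +-identityʳ _ ⟩
  sumBelow b h       ∎
  where open ≡-Reasoning

sum-+ : ∀ b (h k : ℕ → ℕ) → sumBelow b h + sumBelow b k ≡ sumBelow b (λ z → h z + k z)
sum-+ zero    h k = refl
sum-+ (suc b) h k = trans (interchange +-commutativeSemigroup (sumBelow b h) (h b) (sumBelow b k) (k b)) (cong (_+ (h b + k b)) (sum-+ b h k))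

term≤sum : ∀ b (h : ℕ → ℕ) {z} → z < b → h z ≤ sumBelow b h
term≤sum (suc b) h {z} z<1+b with m≤n⇒m<n∨m≡n z<1+b
... | inj₁ (s≤s z<b) = ≤-trans (term≤sum b h z<b) (m≤m+n _ _)
... | inj₂ refl      = m≤n+m _ _

<ᵇ-true : ∀ {m n} → m < n → (m <ᵇ n) ≡ true
<ᵇ-true = Equivalence.to T-≡ ∘ <⇒<ᵇ

<ᵇ-false : ∀ {m n} → n ≤ m → (m <ᵇ n) ≡ false
<ᵇ-false z≤n       = refl
<ᵇ-false (s≤s n≤m) = <ᵇ-false n≤m

-- The halving in `tri` is exact: each step adds the even number `suc k * 2` before halving, so
-- evenness passes from `k` to `suc k`.
tri-double : ∀ k → k * (k + 1) ≡ tri k * 2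
tri-suc : ∀ k → tri (suc k) ≡ tri k + suc k

tri-suc k = begin
  suc k * (suc k + 1) / 2         ≡⟨ cong (_/ 2) (lemma k) ⟩
  (k * (k + 1) + suc k * 2) / 2   ≡⟨ +-distrib-/-∣ʳ (k * (k + 1)) (divides-refl (suc k)) ⟩
  tri k + suc k * 2 / 2           ≡⟨ cong (tri k +_) (m*n/n≡m (suc k) 2) ⟩
  tri k + suc k                   ∎
  where
  open ≡-Reasoning
  lemma : ∀ k → suc k * (suc k + 1) ≡ k * (k + 1) + suc k * 2
  lemma = solve-∀

tri-double zero    = refl
tri-double (suc k) = begin
  suc k * (suc k + 1)       ≡⟨ lemma k ⟩
  k * (k + 1) + suc k * 2   ≡⟨ cong (_+ suc k * 2) (tri-double k) ⟩
  tri k * 2 + suc k * 2     ≡⟨ *-distribʳ-+ 2 (tri k) (suc k) ⟨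
  (tri k + suc k) * 2       ≡⟨ cong (_* 2) (tri-suc k) ⟨
  tri (suc k) * 2           ∎
  where
  open ≡-Reasoning
  lemma : ∀ k → suc k * (suc k + 1) ≡ k * (k + 1) + suc k * 2
  lemma = solve-∀

sum-id : ∀ m → sumBelow (suc m) (λ z → z) ≡ tri m
sum-id zero    = refl
sum-id (suc m) = trans (cong (_+ suc m) (sum-id m)) (sym (tri-suc m))

tri-mono : ∀ {k l} → k ≤ l → tri k ≤ tri l
tri-mono k≤l = /-monoˡ-≤ 2 (*-mono-≤ k≤l (+-monoˡ-≤ 1 k≤l))

-- Weights and boundaries of characteristic functions.

weight : ℕ → (ℕ → Bool) → ℕ
weight b S = sumBelow b (λ z → z * ind (S z))

weight-cong : ∀ b {S S′} → (∀ z → z < b → S z ≡ S′ z) → weight b S ≡ weight b S′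
weight-cong b eq = sum-cong b λ z z<b → cong (λ x → z * ind x) (eq z z<b)

weight-extend : ∀ {b} c {S} → b ≤ c → (∀ z → b ≤ z → S z ≡ false) → weight c S ≡ weight b S
weight-extend c b≤c S≡false = sum-extend c b≤c λ z b≤z → trans (cong (λ x → z * ind x) (S≡false z b≤z)) (*-zeroʳ z)

weight-not : ∀ m S → weight m S + weight m (not ∘ S) ≡ sumBelow m (λ z → z)
weight-not m S = trans (sum-+ m _ _) (sum-cong m λ z _ → split z (S z))
  where
  split : ∀ z s → z * ind s + z * ind (not s) ≡ z
  split z true  = trans (cong₂ _+_ (*-identityʳ z) (*-zeroʳ z)) (+-identityʳ z)
  split z false = trans (cong₂ _+_ (*-zeroʳ z) (*-identityʳ z)) refl

weight-last-true : ∀ b {S} → S b ≡ true → weight (suc b) S ≡ b + weight b S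
weight-last-true b {S} Sb = begin
  weight b S + b * ind (S b) ≡⟨ cong (λ x → weight b S + b * ind x) Sb ⟩
  weight b S + b * 1         ≡⟨ cong (weight b S +_) (*-identityʳ b) ⟩
  weight b S + b             ≡⟨ +-comm (weight b S) b ⟩
  b + weight b S             ∎
  where open ≡-Reasoning

weight-last-false : ∀ b {S} → S b ≡ false → weight (suc b) S ≡ weight b S
weight-last-false b {S} Sb = begin
  weight b S + b * ind (S b) ≡⟨ cong (λ x → weight b S + b * ind x) Sb ⟩
  weight b S + b * 0         ≡⟨ cong (weight b S +_) (*-zeroʳ b) ⟩
  weight b S + 0             ≡⟨ +-identityʳ _ ⟩
  weight b S                 ∎
  where open ≡-Reasoning

boundary-cong : ∀ {S S′} z → (∀ y → y ≤ suc z → S y ≡ S′ y) → inBoundary S z ≡ inBoundary S′ z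
boundary-cong zero    eq = cong (_∧ true) (eq 0 z≤n)
boundary-cong (suc z) eq rewrite eq z (m≤n⇒m≤1+n (n≤1+n z)) | eq (suc z) (n≤1+n _) | eq (suc (suc z)) ≤-refl = refl

boundary-out : ∀ {S} z → S z ≡ false → inBoundary S z ≡ false
boundary-out z Sz rewrite Sz = refl

boundary-in-left : ∀ {S} z → S z ≡ true → leftIn S z ≡ false → inBoundary S z ≡ true
boundary-in-left z Sz Sl rewrite Sz | Sl = refl

boundary-in-right : ∀ {S} z → S z ≡ true → S (suc z) ≡ false → inBoundary S z ≡ true
boundary-in-right {S} z Sz Sr rewrite Sz | Sr | ∧-zeroʳ (leftIn S z) = refl

boundary-interior : ∀ {S} z → leftIn S z ≡ true → S (suc z) ≡ true → inBoundary S z ≡ false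
boundary-interior {S} z Sl Sr rewrite Sl | Sr = ∧-zeroʳ (S z)

-- The range starts at `suc b`, not at `b`: when `b - 1` lies in `S`, the point `b` itself is on the
-- boundary of the complement.
compl-boundary-beyond : ∀ {S b} → (∀ z → b ≤ z → S z ≡ false) → ∀ z → suc b ≤ z → inBoundary (compl S) z ≡ false
compl-boundary-beyond {S} S≡false (suc z) (s≤s b≤z) =
  boundary-interior {compl S} (suc z) (cong not (S≡false z b≤z)) (cong not (S≡false _ (m≤n⇒m≤1+n (m≤n⇒m≤1+n b≤z))))

-- Equal sets may carry different bounds, and function extensionality is not assumed, so invariance
-- under `_≐_` is proved for each functional.
_≐_ : FinSub → FinSub → Set
A ≐ B = ∀ z → mem A z ≡ mem B z

vol-cong : ∀ A B → A ≐ B → vol A ≡ vol B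
vol-cong A B eq = begin
  vol A             ≡⟨ weight-extend c (m≤m+n _ _) (bounded A) ⟨
  weight c (mem A)  ≡⟨ weight-cong c (λ z _ → eq z) ⟩
  weight c (mem B)  ≡⟨ weight-extend c (m≤n+m _ _) (bounded B) ⟩
  vol B             ∎
  where
  open ≡-Reasoning
  c = bound A + bound B

per-cong : ∀ A B → A ≐ B → per A ≡ per B
per-cong A B eq = begin
  per A                          ≡⟨ weight-extend c (m≤m+n _ _) (λ z b≤z → boundary-out z (bounded A z b≤z)) ⟨
  weight c (inBoundary (mem A))  ≡⟨ weight-cong c (λ z _ → boundary-cong z λ y _ → eq y) ⟩
  weight c (inBoundary (mem B))  ≡⟨ weight-extend c (m≤n+m _ _) (λ z b≤z → boundary-out z (bounded B z b≤z)) ⟩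
  per B                          ∎
  where
  open ≡-Reasoning
  c = bound A + bound B

perCompl-cong : ∀ A B → A ≐ B → perCompl A ≡ perCompl B
perCompl-cong A B eq = begin
  perCompl A                             ≡⟨ weight-extend c (s≤s (m≤m+n _ _)) (compl-boundary-beyond (bounded A)) ⟨
  weight c (inBoundary (compl (mem A)))  ≡⟨ weight-cong c (λ z _ → boundary-cong z λ y _ → cong not (eq y)) ⟩
  weight c (inBoundary (compl (mem B)))  ≡⟨ weight-extend c (s≤s (m≤n+m _ _)) (compl-boundary-beyond (bounded B)) ⟩
  perCompl B                             ∎
  where
  open ≡-Reasoning
  c = suc (bound A + bound B)

mem-bound : ∀ A {z} → mem A z ≡ true → z < bound A
mem-bound A {z} z∈A with z <? bound A
... | yes z<b = z<b
... | no  z≮b with trans (sym z∈A) (bounded A z (≮⇒≥ z≮b))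
...   | ()

-- An element contributes itself to the volume. Hence the sets of volume `n` live in {0..n}, which
-- makes the minimisation a finite search.
mem≤vol : ∀ A {z} → mem A z ≡ true → z ≤ vol A
mem≤vol A {z} z∈A = subst (_≤ vol A) (trans (cong (λ x → z * ind x) z∈A) (*-identityʳ z))
                      (term≤sum (bound A) (λ z → z * ind (mem A z)) (mem-bound A z∈A))

vol<⇒∉ : ∀ A {z} → vol A < z → mem A z ≡ false
vol<⇒∉ A {z} v<z with mem A z in eq
... | false = refl
... | true  = ⊥-elim (<⇒≱ v<z (mem≤vol A eq))

-- Splitting a set at its maximum.

-- gap is {0..top} ∖ A, and A′ is A ∖ {top} when top is isolated in A.
record TopSplit (A : FinSub) : Set where
  field
    top            : ℕ
    top<           : top < bound A
    gap            : FinSub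
    gap-bound      : bound gap ≡ top
    vol-gap        : vol A + vol gap ≡ tri top
    perCompl-split : perCompl A ≡ suc top + per gap
    per-split-≤    : per A ≤ top + perCompl gap
    per-split      : per A ≡ top + perCompl gap
                   ⊎ Σ FinSub λ A′ → bound A′ ≡ top × vol A ≡ top + vol A′ × per A ≡ top + per A′

restrict : ℕ → (ℕ → Bool) → FinSub
restrict m S = finSub (λ z → (z <ᵇ m) ∧ S z) m λ z m≤z → cong (_∧ S z) (<ᵇ-false m≤z)

restrict-in : ∀ m S z → z < m → mem (restrict m S) z ≡ S z
restrict-in m S z z<m = cong (_∧ S z) (<ᵇ-true z<m)

module _ (m : ℕ) (S : ℕ → Bool) (S-bounded : ∀ z → suc m ≤ z → S z ≡ false) (m∈S : S m ≡ true) where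
  private
    A : FinSub
    A = finSub S (suc m) S-bounded

    B : FinSub
    B = restrict m (not ∘ S)

    B-low : ∀ y → y ≤ m → compl S y ≡ mem B y
    B-low y y≤m with m≤n⇒m<n∨m≡n y≤m
    ... | inj₁ y<m  = sym (restrict-in m (not ∘ S) y y<m)
    ... | inj₂ refl = trans (cong not m∈S) (sym (bounded B m ≤-refl))

    Bᶜ-low : ∀ y → y ≤ m → S y ≡ compl (mem B) y
    Bᶜ-low y y≤m = trans (sym (not-involutive (S y))) (cong not (B-low y y≤m))

    volume : vol A + vol B ≡ tri m
    volume = begin
      vol A + vol B                              ≡⟨ cong₂ _+_ (weight-last-true m m∈S) (weight-cong m (restrict-in m (not ∘ S))) ⟩
      m + weight m S + weight m (not ∘ S)        ≡⟨ +-assoc m _ _ ⟩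
      m + (weight m S + weight m (not ∘ S))      ≡⟨ cong (m +_) (weight-not m S) ⟩
      m + sumBelow m (λ z → z)                   ≡⟨ +-comm m _ ⟩
      sumBelow (suc m) (λ z → z)                 ≡⟨ sum-id m ⟩
      tri m                                      ∎
      where open ≡-Reasoning

    -- `m ∈ S` puts `suc m` on the boundary of the complement and keeps `m` off it; below `m` the
    -- boundary depends only on points up to `m`, where the complement and `B` agree.
    perimeterᶜ : perCompl A ≡ suc m + per B
    perimeterᶜ = begin
      perCompl A
        ≡⟨ weight-last-true (suc m) (boundary-in-left {compl S} (suc m) (cong not (S-bounded (suc m) ≤-refl)) (cong not m∈S)) ⟩
      suc m + weight (suc m) (inBoundary (compl S))
        ≡⟨ cong (suc m +_) (weight-last-false m (boundary-out {compl S} m (cong not m∈S))) ⟩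
      suc m + weight m (inBoundary (compl S))
        ≡⟨ cong (suc m +_) (weight-cong m λ z z<m → boundary-cong z λ y y≤1+z → B-low y (≤-trans y≤1+z z<m)) ⟩
      suc m + per B
        ∎
      where open ≡-Reasoning

    perimeter : per A ≡ m + weight m (inBoundary S)
    perimeter = weight-last-true m (boundary-in-right {S} m m∈S (S-bounded (suc m) ≤-refl))

    low-boundary : weight m (inBoundary S) ≡ weight m (inBoundary (compl (mem B)))
    low-boundary = weight-cong m λ z z<m → boundary-cong z λ y y≤1+z → Bᶜ-low y (≤-trans y≤1+z z<m)

    -- `perCompl B` has a further summand at `m`, the bound of `B`; dropping it is what leaves an
    -- inequality.
    perimeter-≤ : per A ≤ m + perCompl B
    perimeter-≤ = ≤-trans (≤-reflexive (trans perimeter (cong (m +_) low-boundary))) (+-monoʳ-≤ m (m≤m+n _ _))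

    -- With `m - 1` in `S`, both neighbours of `m` lie outside `B`, so `m` is interior to the
    -- complement of `B` and the further summand vanishes.
    joined : leftIn S m ≡ true → per A ≡ m + perCompl B
    joined l = trans perimeter (cong (m +_) (trans low-boundary (sym (weight-last-false m interior))))
      where
      left : ∀ k → k ≤ m → leftIn S k ≡ leftIn (compl (mem B)) k
      left zero    _   = refl
      left (suc k) k<m = Bᶜ-low k (<⇒≤ k<m)
      interior : inBoundary (compl (mem B)) m ≡ false
      interior = boundary-interior {compl (mem B)} m (trans (sym (left m ≤-refl)) l) (cong not (bounded B (suc m) (n≤1+n m)))

    A′ : FinSub
    A′ = restrict m S

    -- Below `m`, deleting `m` could alter the boundary only at `m - 1`, which is not in `S`.
    isolated-boundary : leftIn S m ≡ false → ∀ z → z < m → inBoundary S z ≡ inBoundary (mem A′) z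
    isolated-boundary l z z<m with m≤n⇒m<n∨m≡n z<m
    ... | inj₁ 1+z<m = boundary-cong z λ y y≤1+z → sym (restrict-in m S y (≤-<-trans y≤1+z 1+z<m))
    ... | inj₂ refl  = trans (boundary-out {S} z l) (sym (boundary-out {mem A′} z (trans (restrict-in m S z z<m) l)))

    isolated : leftIn S m ≡ false → Σ FinSub λ C → bound C ≡ m × vol A ≡ m + vol C × per A ≡ m + per C
    isolated l = A′ , refl
               , trans (weight-last-true m m∈S) (cong (m +_) (weight-cong m λ z z<m → sym (restrict-in m S z z<m)))
               , trans perimeter (cong (m +_) (weight-cong m (isolated-boundary l)))

  topSplit : TopSplit A
  topSplit = record
    { top = m ; top< = ≤-refl ; gap = B ; gap-bound = refl
    ; vol-gap = volume ; perCompl-split = perimeterᶜ ; per-split-≤ = perimeter-≤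
    ; per-split = split (leftIn S m) refl }
    where
    split : ∀ l → leftIn S m ≡ l → per A ≡ m + perCompl B
          ⊎ Σ FinSub λ C → bound C ≡ m × vol A ≡ m + vol C × per A ≡ m + per C
    split true  l = inj₁ (joined l)
    split false l = inj₂ (isolated l)

-- The stored bound need not be tight, so the search descends from it to the largest element; the
-- first alternative is returned only when there is none.
split? : ∀ A → vol A ≡ 0 ⊎ TopSplit A
split? (finSub S b S-bounded) = go b S-bounded
  where
  go : ∀ b bd → vol (finSub S b bd) ≡ 0 ⊎ TopSplit (finSub S b bd)
  step : ∀ b bd s → S b ≡ s → vol (finSub S (suc b) bd) ≡ 0 ⊎ TopSplit (finSub S (suc b) bd)
  lower : ∀ {b} → (∀ z → suc b ≤ z → S z ≡ false) → S b ≡ false → ∀ z → b ≤ z → S z ≡ false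
  lower bd b∉S z b≤z = [ bd z , (λ where refl → b∉S) ]′ (m≤n⇒m<n∨m≡n b≤z)
  go zero    bd = inj₁ refl
  go (suc b) bd = step b bd (S b) refl
  step b bd true  b∈S = inj₂ (topSplit b S bd b∈S)
  step b bd false b∉S with go b (lower bd b∉S)
  ... | inj₁ v≡0 = inj₁ (trans (weight-last-false b {S} b∉S) v≡0)
  ... | inj₂ s   = inj₂ record
    { top            = top s
    ; top<           = m<n⇒m<1+n (top< s)
    ; gap            = gap s
    ; gap-bound      = gap-bound s
    ; vol-gap        = trans (cong (_+ vol (gap s)) vol-eq) (vol-gap s)
    ; perCompl-split = trans (perCompl-cong A (finSub S b (lower bd b∉S)) λ _ → refl) (perCompl-split s)
    ; per-split-≤    = ≤-trans (≤-reflexive per-eq) (per-split-≤ s)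
    ; per-split      = Sum.map (trans per-eq) (λ (C , cb , cv , cp) → C , cb , trans vol-eq cv , trans per-eq cp) (per-split s)
    }
    where
    open TopSplit
    A = finSub S (suc b) bd
    vol-eq = weight-last-false b {S} b∉S
    per-eq = weight-last-false b {inBoundary S} (boundary-out {S} b b∉S)

complementUpTo : ℕ → FinSub → FinSub
complementUpTo m B = restrict (suc m) (not ∘ mem B)

-- Converse of `topSplit`: every element of `B` is at most `vol B < m`, so `m` is the maximum of the
-- complement and the gap below it is `B` again.
complementUpTo-split : ∀ m B → vol B < m → let A = complementUpTo m B in
  vol A + vol B ≡ tri m × per A ≤ m + perCompl B × perCompl A ≡ suc m + per B
complementUpTo-split m B v<m =
    subst (λ v → vol A + v ≡ tri m) (vol-cong gap B gap≐B) vol-gap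
  , subst (λ p → per A ≤ m + p) (perCompl-cong gap B gap≐B) per-split-≤
  , subst (λ p → perCompl A ≡ suc m + p) (per-cong gap B gap≐B) perCompl-split
  where
  A = complementUpTo m B
  low : ∀ z → z ≤ m → mem A z ≡ not (mem B z)
  low z z≤m = restrict-in (suc m) (not ∘ mem B) z (s≤s z≤m)
  s : TopSplit A
  s = topSplit m (mem A) (bounded A) (trans (low m ≤-refl) (cong not (vol<⇒∉ B v<m)))
  open TopSplit s
  gap≐B : gap ≐ B
  gap≐B z with z <? m
  ... | yes z<m = trans (restrict-in m (not ∘ mem A) z z<m) (trans (cong not (low z (<⇒≤ z<m))) (not-involutive (mem B z)))
  ... | no  z≮m = trans (bounded gap z (≮⇒≥ z≮m)) (sym (vol<⇒∉ B (<-≤-trans v<m (≮⇒≥ z≮m))))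

-- Existence of minimising sets.

memBits : List Bool → ℕ → Bool
memBits []       z       = false
memBits (x ∷ xs) zero    = x
memBits (x ∷ xs) (suc z) = memBits xs z

fromBits : List Bool → FinSub
fromBits xs = finSub (memBits xs) (length xs) (beyond xs)
  where
  beyond : ∀ xs z → length xs ≤ z → memBits xs z ≡ false
  beyond []       z       _         = refl
  beyond (x ∷ xs) (suc z) (s≤s l≤z) = beyond xs z l≤z

bitLists : ℕ → List (List Bool)
bitLists zero    = [] ∷ []
bitLists (suc b) = map (true ∷_) (bitLists b) ++ map (false ∷_) (bitLists b)

bitLists-complete : ∀ b (S : ℕ → Bool) → (∀ z → b ≤ z → S z ≡ false) → Σ (List Bool) λ xs → xs ∈ bitLists b × ∀ z → memBits xs z ≡ S z
bitLists-complete zero    S S≡false = [] , here refl , λ z → sym (S≡false z z≤n)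
bitLists-complete (suc b) S S≡false with bitLists-complete b (S ∘ suc) (λ z b≤z → S≡false (suc z) (s≤s b≤z))
... | xs , xs∈ , eq = S 0 ∷ xs , first (S 0) , λ { zero → refl ; (suc z) → eq z }
  where
  first : ∀ s → (s ∷ xs) ∈ bitLists (suc b)
  first true  = ∈-++⁺ˡ (∈-map⁺ (true ∷_) xs∈)
  first false = ∈-++⁺ʳ _ (∈-map⁺ (false ∷_) xs∈)

-- The default that `argmin` requires; it must itself have volume `n`.
singleton : ℕ → FinSub
singleton n = finSub (λ z → (n ≤ᵇ z) ∧ (z <ᵇ suc n)) (suc n) λ z n<z → trans (cong ((n ≤ᵇ z) ∧_) (<ᵇ-false n<z)) (∧-zeroʳ (n ≤ᵇ z))

vol-singleton : ∀ n → vol (singleton n) ≡ n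
vol-singleton n = begin
  weight (suc n) (mem (singleton n)) ≡⟨ weight-last-true n (cong₂ _∧_ (Equivalence.to T-≡ (≤⇒≤ᵇ (≤-refl {n}))) (<ᵇ-true (n<1+n n))) ⟩
  n + weight n (mem (singleton n))   ≡⟨ cong (n +_) (weight-cong n λ z z<n → cong (_∧ (z <ᵇ suc n)) (≤ᵇ-false z<n)) ⟩
  n + weight n (λ _ → false)         ≡⟨ cong (n +_) (weight-extend {0} n {λ _ → false} z≤n λ _ _ → refl) ⟩
  n + 0                              ≡⟨ +-identityʳ n ⟩
  n                                  ∎
  where
  open ≡-Reasoning
  ≤ᵇ-false : ∀ {z n} → z < n → (n ≤ᵇ z) ≡ false
  ≤ᵇ-false (s≤s z≤n′) = <ᵇ-false z≤n′

-- By `vol<⇒∉` every set of volume `n` agrees with a bit list of length `suc n`, so the enumeration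
-- is exhaustive up to `_≐_`, under which `φ` is invariant.
minimiser : (φ : FinSub → ℕ) → (∀ A B → A ≐ B → φ A ≡ φ B) →
            ∀ n → Σ FinSub λ A → vol A ≡ n × ∀ B → vol B ≡ n → φ A ≤ φ B
minimiser φ φ-cong n = best , best-vol , best-min
  where
  hasVol? = λ (A : FinSub) → vol A ≟ n
  candidates = filter hasVol? (map fromBits (bitLists (suc n)))
  best = argmin φ (singleton n) candidates
  best-vol : vol best ≡ n
  best-vol = argmin-all φ {P = λ A → vol A ≡ n} (vol-singleton n)
               (tabulate λ A∈ → proj₂ (∈-filter⁻ hasVol? {xs = map fromBits (bitLists (suc n))} A∈))
  best-min : ∀ B → vol B ≡ n → φ best ≤ φ B
  best-min B refl with bitLists-complete (suc n) (mem B) (λ z v<z → vol<⇒∉ B v<z)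
  ... | xs , xs∈ , eq = f[argmin]≤v⁺ {f = φ} (singleton n) candidates
    (inj₂ (lose (∈-filter⁺ hasVol? (∈-map⁺ fromBits xs∈) (vol-cong (fromBits xs) B eq)) (≤-reflexive (φ-cong (fromBits xs) B eq))))

-- The functions `f` and `g`.

isqrt-spec : ∀ m → isqrt m * isqrt m ≤ m × m < suc (isqrt m) * suc (isqrt m)
isqrt-spec zero    = z≤n , s≤s z≤n
isqrt-spec (suc m) with isqrt m | isqrt-spec m
... | r | lo , hi with suc r * suc r ≤ᵇ suc m in eq
...   | true  = ≤ᵇ⇒≤ (suc r * suc r) (suc m) (subst T (sym eq) _)
              , ≤-<-trans hi (*-mono-< (n<1+n (suc r)) (n<1+n (suc r)))
...   | false = m≤n⇒m≤1+n lo , ≰⇒> λ le → subst T eq (≤⇒≤ᵇ le)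

-- Turns `n ≤ tri k` into `8 * n < (2k + 1)²`, the form in which `isqrt (8 * n)` can be compared
-- with `2k + 1`.
square-odd : ∀ k → suc (k + k) * suc (k + k) ≡ suc (8 * tri k)
square-odd k = begin
  suc (k + k) * suc (k + k)  ≡⟨ expand k ⟩
  suc (4 * (k * (k + 1)))    ≡⟨ cong (λ t → suc (4 * t)) (tri-double k) ⟩
  suc (4 * (tri k * 2))      ≡⟨ cong suc (regroup (tri k)) ⟩
  suc (8 * tri k)            ∎
  where
  open ≡-Reasoning
  expand : ∀ k → suc (k + k) * suc (k + k) ≡ suc (4 * (k * (k + 1)))
  expand = solve-∀
  regroup : ∀ t → 4 * (t * 2) ≡ 8 * t
  regroup = solve-∀

square-cancel-< : ∀ {m n} → m * m < n * n → m < n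
square-cancel-< {m} {n} m²<n² with m <? n
... | yes m<n = m<n
... | no  m≮n = ⊥-elim (<⇒≱ m²<n² (*-mono-≤ (≮⇒≥ m≮n) (≮⇒≥ m≮n)))

double : ∀ k → k * 2 ≡ k + k
double = solve-∀

-- Together with `f-least` this characterises `f n` as the least `k` with `n ≤ tri k`; the formula
-- for `f` is not unfolded after that.
n≤tri-f : ∀ n → n ≤ tri (f n)
n≤tri-f n = *-cancelˡ-≤ 8 (s≤s⁻¹ (begin
  suc (8 * n)                          ≤⟨ proj₂ (isqrt-spec (8 * n)) ⟩
  suc r * suc r                        ≤⟨ *-mono-≤ r≤ r≤ ⟩
  suc (f n + f n) * suc (f n + f n)    ≡⟨ square-odd (f n) ⟩
  suc (8 * tri (f n))                  ∎))
  where
  open ≤-Reasoning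
  r = isqrt (8 * n)
  r≤ : suc r ≤ suc (f n + f n)
  r≤ = begin
    suc r                     ≡⟨ +-comm 1 r ⟩
    r + 1                     ≡⟨ m≡m%n+[m/n]*n (r + 1) 2 ⟩
    (r + 1) % 2 + f n * 2     ≤⟨ +-mono-≤ (s≤s⁻¹ (m%n<n (r + 1) 2)) (≤-reflexive (double (f n))) ⟩
    suc (f n + f n)           ∎

f-least : ∀ {n k} → n ≤ tri k → f n ≤ k
f-least {n} {k} n≤tri = s≤s⁻¹ (m<n*o⇒m/o<n (begin-strict
  r + 1              <⟨ +-monoˡ-< 1 r< ⟩
  suc (k + k) + 1    ≡⟨ regroup k ⟩
  suc k * 2          ∎))
  where
  open ≤-Reasoning
  r = isqrt (8 * n)
  r< : r < suc (k + k)
  r< = square-cancel-< (begin-strict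
    r * r                      ≤⟨ proj₁ (isqrt-spec (8 * n)) ⟩
    8 * n                      ≤⟨ *-monoʳ-≤ 8 n≤tri ⟩
    8 * tri k                  <⟨ n<1+n _ ⟩
    suc (8 * tri k)            ≡⟨ square-odd k ⟨
    suc (k + k) * suc (k + k)  ∎)
  regroup : ∀ k → suc (k + k) + 1 ≡ suc k * 2
  regroup = solve-∀

<f : ∀ {k x} → tri k < x → k < f x
<f {k} {x} tri<x = ≰⇒> λ f≤k → <⇒≱ tri<x (≤-trans (n≤tri-f x) (tri-mono f≤k))

tri-f : ∀ n → tri (f n) ≡ n + g n
tri-f n = sym (m+[n∸m]≡n (n≤tri-f n))

tri-pred : ∀ {k} → 1 ≤ k → tri k ≡ tri (k ∸ 1) + k
tri-pred {suc k} _ = tri-suc k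

g-least : ∀ n {k h} → tri k ≡ n + h → g n ≤ h
g-least n {k} {h} eq = +-cancelˡ-≤ n _ _ (begin
  n + g n     ≡⟨ tri-f n ⟨
  tri (f n)   ≤⟨ tri-mono (f-least {k = k} (≤-trans (m≤m+n n h) (≤-reflexive (sym eq)))) ⟩
  tri k       ≡⟨ eq ⟩
  n + h       ∎)
  where open ≤-Reasoning

1≤f : ∀ {n} → 1 ≤ n → 1 ≤ f n
1≤f = <f

tri-f∸1< : ∀ {n} → 1 ≤ n → tri (f n ∸ 1) < n
tri-f∸1< {n} 1≤n = ≰⇒> λ n≤ → <-irrefl refl (begin-strict
  f n ∸ 1 <⟨ ∸-monoʳ-< {f n} (s≤s z≤n) (1≤f 1≤n) ⟩
  f n     ≤⟨ f-least n≤ ⟩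
  f n ∸ 1 ∎)
  where open ≤-Reasoning

-- Hence every `n ≥ 1` has the form `tri F - G` with `G < F`. These `n` make up row `F`, and later
-- lemmas take such `F` and `G` as variables in place of `f n` and `g n`.
g<f : ∀ {n} → 1 ≤ n → g n < f n
g<f {n} 1≤n = +-cancelˡ-< n _ _ (begin-strict
  n + g n              ≡⟨ tri-f n ⟨
  tri (f n)            ≡⟨ tri-pred (1≤f 1≤n) ⟩
  tri (f n ∸ 1) + f n  <⟨ +-monoˡ-< (f n) (tri-f∸1< 1≤n) ⟩
  n + f n              ∎)
  where open ≤-Reasoning

k≤tri : ∀ k → k ≤ tri k
k≤tri zero    = z≤n
k≤tri (suc k) = ≤-trans (m≤n+m (suc k) (tri k)) (≤-reflexive (sym (tri-suc k)))

-- A candidate table of `P` and `Q`.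

-- [m₁, m₂, m₃, …] encodes {0..m₁} ∖ ({0..m₂} ∖ ({0..m₃} ∖ …)).
runs : List ℕ → FinSub
runs []       = finSub (λ _ → false) 0 λ _ _ → refl
runs (m ∷ ms) = complementUpTo m (runs ms)

-- The members of E covered by the table, each with an optimal set for P and one for Q.
exceptions : List (ℕ × List ℕ × List ℕ)
exceptions =
  (2 , 2 ∷ 1 ∷ [] , 2 ∷ 1 ∷ []) ∷
  (4 , 3 ∷ 2 ∷ 1 ∷ [] , 3 ∷ 2 ∷ 1 ∷ []) ∷
  (7 , 4 ∷ 3 ∷ 2 ∷ [] , 4 ∷ 2 ∷ []) ∷
  (8 , 5 ∷ 4 ∷ 2 ∷ [] , 4 ∷ 2 ∷ 1 ∷ []) ∷
  (11 , 5 ∷ 4 ∷ 3 ∷ [] , 5 ∷ 3 ∷ 2 ∷ 1 ∷ []) ∷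
  (16 , 6 ∷ 5 ∷ 4 ∷ [] , 6 ∷ 3 ∷ 1 ∷ []) ∷
  (17 , 7 ∷ 6 ∷ 4 ∷ [] , 6 ∷ 3 ∷ 2 ∷ 1 ∷ []) ∷
  (29 , 8 ∷ 7 ∷ 6 ∷ [] , 8 ∷ 4 ∷ 3 ∷ 2 ∷ []) ∷
  (92 , 14 ∷ 5 ∷ 2 ∷ 1 ∷ [] , 15 ∷ 7 ∷ []) ∷
  (125 , 17 ∷ 7 ∷ [] , 16 ∷ 5 ∷ 4 ∷ 3 ∷ []) ∷
  (154 , 19 ∷ 8 ∷ [] , 19 ∷ 8 ∷ []) ∷
  (155 , 19 ∷ 8 ∷ 1 ∷ [] , 18 ∷ 6 ∷ 5 ∷ 4 ∷ []) ∷
  (174 , 20 ∷ 8 ∷ [] , 20 ∷ 8 ∷ []) ∷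
  (361 , 27 ∷ 6 ∷ 3 ∷ 2 ∷ 1 ∷ [] , 28 ∷ 9 ∷ []) ∷
  (390 , 29 ∷ 9 ∷ [] , 28 ∷ 6 ∷ 5 ∷ 4 ∷ []) ∷
  (441 , 30 ∷ 7 ∷ 3 ∷ 2 ∷ 1 ∷ [] , 31 ∷ 10 ∷ []) ∷
  (473 , 32 ∷ 10 ∷ [] , 32 ∷ 10 ∷ []) ∷
  (529 , 33 ∷ 8 ∷ 3 ∷ 2 ∷ 1 ∷ [] , 34 ∷ 11 ∷ []) ∷
  (564 , 35 ∷ 11 ∷ [] , 35 ∷ 11 ∷ []) ∷
  (601 , 36 ∷ 11 ∷ 1 ∷ [] , 35 ∷ 8 ∷ 7 ∷ 6 ∷ []) ∷
  (637 , 37 ∷ 11 ∷ [] , 37 ∷ 11 ∷ []) ∷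
  (704 , 39 ∷ 12 ∷ 2 ∷ 1 ∷ [] , 38 ∷ 9 ∷ 4 ∷ 2 ∷ 1 ∷ []) ∷
  (742 , 40 ∷ 12 ∷ [] , 40 ∷ 12 ∷ []) ∷
  (743 , 40 ∷ 12 ∷ 1 ∷ [] , 40 ∷ 12 ∷ 1 ∷ []) ∷
  (783 , 41 ∷ 12 ∷ [] , 41 ∷ 12 ∷ []) ∷
  (837 , 41 ∷ 7 ∷ 3 ∷ 2 ∷ 1 ∷ [] , 42 ∷ 11 ∷ []) ∷
  (1003 , 45 ∷ 8 ∷ 3 ∷ 2 ∷ 1 ∷ [] , 46 ∷ 12 ∷ []) ∷
  (1147 , 49 ∷ 12 ∷ [] , 49 ∷ 12 ∷ []) ∷
  (1184 , 49 ∷ 9 ∷ 3 ∷ 2 ∷ 1 ∷ [] , 50 ∷ 13 ∷ []) ∷ []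

-- Values follow the recursion except at the listed `n`. Nothing is proved about this construction:
-- the table is a mere candidate, certified by the tests below.
entry : ℕ → ℕ → ℕ × ℕ → List (ℕ × List ℕ × List ℕ) → ℕ × ℕ
entry F n (p , q) [] = F + q , suc F + p
entry F n v ((k , a , b) ∷ es) = if n ≡ᵇ k then (per (runs a) , perCompl (runs b)) else entry F n v es

-- The list holds the values at F - 1, …, 0, so that the n-th value comes from F and n = tri F - G.
row : ℕ → ℕ → List (ℕ × ℕ) → List (ℕ × ℕ)
row F n []       = []
row F n (v ∷ vs) = entry F n v exceptions ∷ row F (suc n) vs

addRow : ℕ → List (ℕ × ℕ) → List (ℕ × ℕ)
addRow k vs = vs ++ row (suc k) (suc (tri k)) (reverse (take (suc k) vs))

rows : ℕ → List (ℕ × ℕ)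
rows zero    = (0 , 0) ∷ []
rows (suc k) = addRow k (rows k)

-- Indexed by binary digits, the least significant one first.
data Trie : Set where
  leaf : ℕ → ℕ → Trie
  node : Trie → Trie → Trie

evens odds : List (ℕ × ℕ) → List (ℕ × ℕ)
evens []       = []
evens (v ∷ vs) = v ∷ odds vs
odds []       = []
odds (v ∷ vs) = evens vs

fromList : ℕ → List (ℕ × ℕ) → Trie
fromList zero    []            = leaf 0 0
fromList zero    ((p , q) ∷ _) = leaf p q
fromList (suc d) vs            = node (fromList d (evens vs)) (fromList d (odds vs))

tabP tabQ : Trie → ℕ → ℕ
tabP (leaf p q) n = p
tabP (node l r) n = if n % 2 ≡ᵇ 0 then tabP l (n / 2) else tabP r (n / 2)
tabQ (leaf p q) n = q
tabQ (node l r) n = if n % 2 ≡ᵇ 0 then tabQ l (n / 2) else tabQ r (n / 2)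

-- Boolean tests on the table.

allBelow : ℕ → (ℕ → Bool) → Bool
allBelow zero    p = true
allBelow (suc n) p = p n ∧ allBelow n p

-- Tests ok from m on until stop holds, and fails when the fuel runs out.
scan : (stop ok : ℕ → Bool) → ℕ → ℕ → Bool
scan stop ok zero       m = stop m
scan stop ok (suc fuel) m = stop m ∨ (ok m ∧ scan stop ok fuel (suc m))

elem : ℕ → List ℕ → Bool
elem n = any (n ≡ᵇ_)

size : ℕ → ℕ
size N = suc (tri N)

-- Outside the table, suc N ≤ f x ≤ P x, Q x.
lowP lowQ : ℕ → Trie → ℕ → ℕ
lowP N t x = if x <ᵇ size N then tabP t x else suc N
lowQ N t x = if x <ᵇ size N then tabQ t x else suc N

-- Induction step of the lower bounds: `m` ranges over the possible maxima of a set of volume `n`,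
-- and `ok` covers the alternatives of `TopSplit`, the last for an isolated maximum. Once `m` alone
-- reaches the table values, larger `m` are harmless.
lowerAt : ℕ → Trie → ℕ → ℕ → Bool
lowerAt N t F n = scan (λ m → (tabP t n ≤ᵇ m) ∧ (tabQ t n ≤ᵇ suc m)) ok (suc N) F
  where
  ok : ℕ → Bool
  ok m = (tabP t n ≤ᵇ m + lowQ N t (tri m ∸ n)) ∧ (tabQ t n ≤ᵇ suc m + lowP N t (tri m ∸ n))
       ∧ ((n <ᵇ m) ∨ (tabP t n ≤ᵇ m + lowP N t (n ∸ m)))

lowerCheck : ℕ → Trie → Bool
lowerCheck N t = allBelow (suc N) λ F → allBelow F λ G → lowerAt N t F (tri F ∸ G)

witnessP witnessQ : ℕ → ℕ → ℕ × List ℕ × List ℕ → Bool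
witnessP n v (k , a , b) = (n ≡ᵇ k) ∧ (vol (runs a) ≡ᵇ n) ∧ (per (runs a) ≤ᵇ v)
witnessQ n v (k , a , b) = (n ≡ᵇ k) ∧ (vol (runs b) ≡ᵇ n) ∧ (perCompl (runs b) ≤ᵇ v)

-- An upper bound needs just one set: the complement in {0..F} of an optimal set for `G`, or one
-- listed in `exceptions`.
upperAt : Trie → ℕ → ℕ → ℕ → Bool
upperAt t F G n = ((F + tabQ t G ≤ᵇ tabP t n) ∨ any (witnessP n (tabP t n)) exceptions)
                ∧ ((suc F + tabP t G ≤ᵇ tabQ t n) ∨ any (witnessQ n (tabQ t n)) exceptions)

upperCheck : ℕ → Trie → Bool
upperCheck N t = allBelow (suc N) λ F → allBelow F λ G → upperAt t F G (tri F ∸ G)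

-- The bound `8 + n/4` with denominators cleared.
slopeCheck : ℕ → Trie → Bool
slopeCheck N t = allBelow (size N) λ n → (4 * tabP t n ≤ᵇ 32 + n) ∧ (4 * tabQ t n ≤ᵇ 32 + n)

-- Implies u ≤ j + f x for the x of the j-th competitor, and for all later ones.
beyond : ℕ → ℕ → ℕ → ℕ → Bool
beyond u F G j = tri (u ∸ suc j) <ᵇ (tri (F + j) ∸ tri F) + G

-- The competitor with maximum `F + j` is tested from `j = 1` on, because `j = 0` leaves exactly the
-- volume `G`.
dominatedCheckAt : ℕ → Trie → ℕ → ℕ → ℕ → Bool
dominatedCheckAt N t u G F = scan (beyond u F G) (λ j → ok j ((tri (F + j) ∸ tri F) + G)) (suc N) 1 ∨ elem (tri F ∸ G) E
  where
  ok : ℕ → ℕ → Bool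
  ok j x = (tabP t G ≤ᵇ j + lowP N t x) ∧ (tabQ t G ≤ᵇ j + lowQ N t x)

-- Raising `F` enlarges the volumes to be compared, so the scan may stop at the first `F` for which
-- `beyond` holds with `j = 1`.
dominatedCheckRow : ℕ → Trie → ℕ → ℕ → Bool
dominatedCheckRow N t u G = scan (λ F → beyond u F G 1) (dominatedCheckAt N t u G) (size N) (suc G)

-- The `1` is subtracted because the a priori lower bound for `Q` exceeds that for `P` by one; a
-- single `u` then serves both.
dominatedCheck : ℕ → Trie → Bool
dominatedCheck N t = allBelow (size N) λ G → dominatedCheckRow N t (tabP t G ⊔ (tabQ t G ∸ 1)) G

-- Removing an isolated maximum `F + j` from volume `tri F - G` leaves `tri F - (j + F + G)`. Values
-- of `j` without room for this are skipped, and `j ≥ tabQ t G` suffices by itself.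
isolatedCheckAt : ℕ → Trie → ℕ → ℕ → Bool
isolatedCheckAt N t F G = allBelow (tabQ t G) ok ∨ elem (tri F ∸ G) E
  where
  ok : ℕ → Bool
  ok j = (tri F <ᵇ j + F + G) ∨ (tabQ t G ≤ᵇ j + lowP N t (tri F ∸ (j + F + G)))

-- Rows from `16` on are covered by the estimate in `isolated-large`.
isolatedCheck : ℕ → Trie → Bool
isolatedCheck N t = allBelow 16 λ F → allBelow F (isolatedCheckAt N t F)

-- Soundness of the test combinators.

∧-elim : ∀ {a b} → T (a ∧ b) → T a × T b
∧-elim = Equivalence.to T-∧

∨-elim : ∀ {a b} → T (a ∨ b) → T a ⊎ T b
∨-elim = Equivalence.to T-∨

holds : ∀ {b} → b ≡ true → T b
holds = Equivalence.from T-≡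

allBelow-sound : ∀ n {p} → T (allBelow n p) → ∀ {k} → k < n → T (p k)
allBelow-sound (suc n) {p} ok k<1+n with m≤n⇒m<n∨m≡n k<1+n
... | inj₁ (s≤s k<n) = allBelow-sound n (proj₂ (∧-elim {p n} ok)) k<n
... | inj₂ refl      = proj₁ (∧-elim ok)

-- `stop` has to vouch for all later indices, so a finite scan reaches an unbounded range. Exhausted
-- fuel yields `stop m`, hence too little fuel can only make a test fail.
scan-sound : ∀ {stop ok} {R : ℕ → Set} →
             (∀ {m k} → m ≤ k → T (stop m) → R k) → (∀ m → T (ok m) → R m) →
             ∀ fuel {m} → T (scan stop ok fuel m) → ∀ {k} → m ≤ k → R k
scan-sound stop→ ok→ zero t m≤k = stop→ m≤k t
scan-sound {stop} {ok} stop→ ok→ (suc fuel) {m} t m≤k with ∨-elim {stop m} t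
... | inj₁ s = stop→ m≤k s
... | inj₂ r with m≤n⇒m<n∨m≡n m≤k
...   | inj₁ m<k  = scan-sound stop→ ok→ fuel (proj₂ (∧-elim {ok m} r)) m<k
...   | inj₂ refl = ok→ m (proj₁ (∧-elim r))

elem-sound : ∀ n xs → T (elem n xs) → n ∈ xs
elem-sound n xs t = Any.map (≡ᵇ⇒≡ n _) (any⁻ (n ≡ᵇ_) xs t)

-- Arithmetic of rows and growth estimates.

tri-4+ : ∀ e → tri (4 + e) ≡ tri e + suc e + (2 + e) + (3 + e) + (4 + e)
tri-4+ e = trans (tri-suc (3 + e)) (cong (_+ (4 + e)) (trans (tri-suc (2 + e)) (cong (_+ (3 + e))
             (trans (tri-suc (1 + e)) (cong (_+ (2 + e)) (tri-suc e))))))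

row-pred : ∀ {F G n} → tri F ≡ n + G → G < F → tri (F ∸ 1) < n
row-pred {F} {G} {n} eq G<F = +-cancelʳ-< G _ _ (begin-strict
  tri (F ∸ 1) + G  <⟨ +-monoʳ-< (tri (F ∸ 1)) G<F ⟩
  tri (F ∸ 1) + F  ≡⟨ tri-pred (≤-trans (s≤s z≤n) G<F) ⟨
  tri F            ≡⟨ eq ⟩
  n + G            ∎)
  where open ≤-Reasoning

row-least : ∀ {F G n m} → tri F ≡ n + G → G < F → n ≤ tri m → F ≤ m
row-least {F} {G} {n} {m} eq G<F n≤tri = ≮⇒≥ λ m<F →
  <⇒≱ (row-pred eq G<F) (≤-trans n≤tri (tri-mono (∸-monoˡ-≤ 1 m<F)))

row-∸ : ∀ F G {n} → tri F ≡ n + G → tri F ∸ G ≡ n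
row-∸ F G {n} eq = trans (cong (_∸ G) eq) (m+n∸n≡m n G)

-- `G ≤ F - 1 ≤ tri (F - 1) < n`, which makes the passage from `n` to `G` well founded.
row-< : ∀ {F G n} → tri F ≡ n + G → G < F → G < n
row-< {suc F} {G} {n} eq G<F = ≤-<-trans (≤-trans (s≤s⁻¹ G<F) (k≤tri F)) (row-pred eq G<F)

-- `F ≥ 12` gives `tri F ≥ 6 (F + 1)`: four of the six pay for a recursion step multiplied by 4, the
-- other two for `G` on both sides. This lets the slope `1/4` reproduce itself.
rec-slope : ∀ {F G y} → 12 ≤ F → G < F → tri F ≡ y + G → 4 * suc F + G ≤ y
rec-slope {F} {G} {y} 12≤F G<F eq = +-cancelʳ-≤ G _ _ (begin
  4 * suc F + G + G               ≤⟨ +-mono-≤ (+-monoʳ-≤ (4 * suc F) G≤) G≤ ⟩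
  4 * suc F + suc F + suc F       ≡⟨ regroup F ⟩
  6 * (F + 1)                     ≤⟨ *-cancelʳ-≤ (6 * (F + 1)) (tri F) 2 six ⟩
  tri F                           ≡⟨ eq ⟩
  y + G                           ∎)
  where
  open ≤-Reasoning
  G≤ : G ≤ suc F
  G≤ = ≤-trans (<⇒≤ G<F) (n≤1+n F)
  regroup : ∀ F → 4 * suc F + suc F + suc F ≡ 6 * (F + 1)
  regroup = solve-∀
  regroup′ : ∀ F → 6 * (F + 1) * 2 ≡ 12 * (F + 1)
  regroup′ = solve-∀
  six : 6 * (F + 1) * 2 ≤ tri F * 2
  six = begin
    6 * (F + 1) * 2  ≡⟨ regroup′ F ⟩
    12 * (F + 1)     ≤⟨ *-monoˡ-≤ (F + 1) 12≤F ⟩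
    F * (F + 1)      ≡⟨ tri-double F ⟩
    tri F * 2        ∎

row-large : ∀ {F G n N} → tri F ≡ n + G → tri N < n → N < F
row-large {F} {G} {n} eq tri<n = ≰⇒> λ F≤N →
  <⇒≱ tri<n (≤-trans (≤-trans (m≤m+n n G) (≤-reflexive (sym eq))) (tri-mono F≤N))

rows-rec : (R : ℕ → Set) → R 0 → (∀ {F G n} → tri F ≡ n + G → G < F → R G → R n) → ∀ n → R n
rows-rec R r0 row = <-rec R λ where
  zero      ih → r0
  n@(suc _) ih → row {f n} {g n} (tri-f n) (g<f {n} (s≤s z≤n)) (ih (row-< {f n} {g n} (tri-f n) (g<f {n} (s≤s z≤n))))

-- For k = f G and h = g G the conclusion says u ≤ 1 + f (2G + 2): since f (2G) is about √2 k, it outgrows 5k/4.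
slope-beaten : ∀ {k G h u} → 50 ≤ k → h < k → tri k ≡ G + h → 4 * u ≤ 35 + 5 * k → tri (u ∸ 2) < suc (suc (G + G))
slope-beaten {suc e} {G} {h} {u} 50≤k h<k eq 4u≤ = *-cancelˡ-< 32 _ _ (begin-strict
  32 * tri v                                       ≡⟨ regroup₁ (tri v) ⟩
  16 * (tri v * 2)                                 ≡⟨ cong (16 *_) (tri-double v) ⟨
  16 * (v * (v + 1))                               ≡⟨ regroup₂ v ⟩
  4 * v * (4 * v + 4)                              ≤⟨ *-mono-≤ 4v≤ (+-monoˡ-≤ 4 4v≤) ⟩
  -- The decisive comparison is that of the leading coefficients, `25 < 32`, that is `(5/4)² < 2`.
  (27 + 5 * suc e) * (27 + 5 * suc e + 4)          ≡⟨ expand e ⟩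
  25 * (e * e) + (32 * e + 128) + (308 * e + 1024) <⟨ +-monoʳ-< (25 * (e * e) + (32 * e + 128)) quadratic ⟩
  25 * (e * e) + (32 * e + 128) + 7 * (e * e)      ≡⟨ regroup₃ e ⟩
  32 * (e * (e + 1) + 4)                           ≡⟨ cong (λ x → 32 * (x + 4)) (tri-double e) ⟩
  32 * (tri e * 2 + 4)                             ≡⟨ cong (32 *_) (regroup₄ (tri e)) ⟩
  32 * suc (suc (suc (tri e) + suc (tri e)))       ≤⟨ *-monoʳ-≤ 32 (s≤s (s≤s (+-mono-≤ tri<G tri<G))) ⟩
  32 * suc (suc (G + G))                           ∎)
  where
  open ≤-Reasoning
  v = u ∸ 2
  4v≤ : 4 * v ≤ 27 + 5 * suc e
  4v≤ = ≤-trans (≤-reflexive (*-distribˡ-∸ 4 u 2)) (∸-monoˡ-≤ 8 4u≤)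
  49≤e : 49 ≤ e
  49≤e = s≤s⁻¹ 50≤k
  -- `e ≥ 49` gives `7e² ≥ 343e = 308e + 35e`, and `35 * 49 = 1715` exceeds `1024`.
  quadratic : 308 * e + 1024 < 7 * (e * e)
  quadratic = begin-strict
    308 * e + 1024    <⟨ +-monoʳ-< (308 * e) (≤ᵇ⇒≤ 1025 (35 * 49) _) ⟩
    308 * e + 35 * 49 ≤⟨ +-monoʳ-≤ (308 * e) (*-monoʳ-≤ 35 49≤e) ⟩
    308 * e + 35 * e  ≡⟨ *-distribʳ-+ e 308 35 ⟨
    343 * e           ≡⟨ *-assoc 7 49 e ⟩
    7 * (49 * e)      ≤⟨ *-monoʳ-≤ 7 (*-monoˡ-≤ e 49≤e) ⟩
    7 * (e * e)       ∎
  tri<G : tri e < G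
  tri<G = row-pred eq h<k
  regroup₁ : ∀ t → 32 * t ≡ 16 * (t * 2)
  regroup₁ = solve-∀
  regroup₂ : ∀ v → 16 * (v * (v + 1)) ≡ 4 * v * (4 * v + 4)
  regroup₂ = solve-∀
  regroup₃ : ∀ e → 25 * (e * e) + (32 * e + 128) + 7 * (e * e) ≡ 32 * (e * (e + 1) + 4)
  regroup₃ = solve-∀
  regroup₄ : ∀ t → t * 2 + 4 ≡ suc (suc (suc t + suc t))
  regroup₄ = solve-∀
  expand : ∀ e → (27 + 5 * suc e) * (27 + 5 * suc e + 4) ≡ 25 * (e * e) + (32 * e + 128) + (308 * e + 1024)
  expand = solve-∀

-- The volume of the complement in {0..F+j} of a set of volume tri F - G.
excess : ℕ → ℕ → ℕ → ℕ
excess F G j = (tri (F + j) ∸ tri F) + G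

excess-one : ∀ F G → excess F G 1 ≡ suc F + G
excess-one F G = cong (_+ G) (trans (cong (λ k → tri k ∸ tri F) (+-comm F 1))
                                    (trans (cong (_∸ tri F) (tri-suc F)) (m+n∸m≡n (tri F) (suc F))))

excess-mono : ∀ F G {j k} → j ≤ k → excess F G j ≤ excess F G k
excess-mono F G j≤k = +-monoˡ-≤ G (∸-monoˡ-≤ (tri F) (tri-mono (+-monoʳ-≤ F j≤k)))

-- Recursive inequalities for the minima.

module Minima (P Q : ℕ → ℕ) (isP : ∀ n → IsP n (P n)) (isQ : ∀ n → IsQ n (Q n)) where

  P-≤ : ∀ A → P (vol A) ≤ per A
  P-≤ A = proj₂ (isP (vol A)) A refl

  Q-≤ : ∀ A → Q (vol A) ≤ perCompl A
  Q-≤ A = proj₂ (isQ (vol A)) A refl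

  -- Complement an optimal set for `G` in {0..F}; its volume `G < F` keeps `F` out of it, as
  -- `complementUpTo-split` requires.
  complement-upper : ∀ {F G n} → tri F ≡ n + G → G < F → P n ≤ F + Q G × Q n ≤ suc F + P G
  complement-upper {F} {G} {n} eq G<F = P-bound (isQ G) , Q-bound (isP G)
    where
    open ≤-Reasoning
    vol-complement : ∀ B {v} → v + vol B ≡ tri F → vol B ≡ G → v ≡ n
    vol-complement B {v} sum vB = +-cancelʳ-≡ G v n (trans (cong (v +_) (sym vB)) (trans sum eq))
    P-bound : IsQ G (Q G) → P n ≤ F + Q G
    P-bound ((B , vB , qB) , _) with complementUpTo-split F B (subst (_< F) (sym vB) G<F)
    ... | sum , p≤ , _ = begin
      P n               ≡⟨ cong P (vol-complement B sum vB) ⟨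
      P (vol A)         ≤⟨ P-≤ A ⟩
      per A             ≤⟨ p≤ ⟩
      F + perCompl B    ≡⟨ cong (F +_) qB ⟩
      F + Q G           ∎
      where A = complementUpTo F B
    Q-bound : IsP G (P G) → Q n ≤ suc F + P G
    Q-bound ((B , vB , pB) , _) with complementUpTo-split F B (subst (_< F) (sym vB) G<F)
    ... | sum , _ , q≡ = begin
      Q n               ≡⟨ cong Q (vol-complement B sum vB) ⟨
      Q (vol A)         ≤⟨ Q-≤ A ⟩
      perCompl A        ≡⟨ q≡ ⟩
      suc F + per B     ≡⟨ cong (suc F +_) pB ⟩
      suc F + P G       ∎
      where A = complementUpTo F B

  -- Splits an optimal set at its maximum `m`; the second alternative is an isolated maximum.
  P-step : ∀ {n} → 1 ≤ n → Σ ℕ λ m → n ≤ tri m ×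
           (Σ ℕ (λ x → n + x ≡ tri m × m + Q x ≤ P n) ⊎ Σ ℕ (λ x → n ≡ m + x × m + P x ≤ P n))
  P-step {n} 1≤n with isP n
  ... | (A , refl , pA) , _ with split? A
  ...   | inj₁ v≡0 = ⊥-elim (<⇒≢ 1≤n (sym v≡0))
  ...   | inj₂ s   = top s , ≤-trans (m≤m+n n _) (≤-reflexive (vol-gap s)) , Sum.map
    (λ p≡ → vol (gap s) , vol-gap s , ≤-trans (+-monoʳ-≤ (top s) (Q-≤ (gap s))) (≤-reflexive (trans (sym p≡) pA)))
    (λ (A′ , _ , v≡ , p≡) → vol A′ , v≡ , ≤-trans (+-monoʳ-≤ (top s) (P-≤ A′)) (≤-reflexive (trans (sym p≡) pA)))
    (per-split s)
    where open TopSplit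

  Q-step : ∀ {n} → 1 ≤ n → Σ ℕ λ m → Σ ℕ λ x → n + x ≡ tri m × suc m + P x ≤ Q n
  Q-step {n} 1≤n with isQ n
  ... | (A , refl , qA) , _ with split? A
  ...   | inj₁ v≡0 = ⊥-elim (<⇒≢ 1≤n (sym v≡0))
  ...   | inj₂ s   = top s , vol (gap s) , vol-gap s
                   , ≤-trans (+-monoʳ-≤ (suc (top s)) (P-≤ (gap s))) (≤-reflexive (trans (sym (perCompl-split s)) qA))
    where open TopSplit

  -- A volume above `tri k` forces a maximum above `k`, and the maximum lies on the boundary.
  tri<⇒<P : ∀ {k n} → tri k < n → k < P n
  tri<⇒<P {k} {n} tri<n with P-step (≤-trans (s≤s z≤n) tri<n)
  ... | m , n≤tri , choice = <-≤-trans k<m ([ (λ (_ , _ , le) → m+n≤o⇒m≤o m le) , (λ (_ , _ , le) → m+n≤o⇒m≤o m le) ]′ choice)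
    where
    k<m : k < m
    k<m = ≰⇒> λ m≤k → <⇒≱ tri<n (≤-trans n≤tri (tri-mono m≤k))

  -- One better than for `P`: the boundary point of the complement is the maximum plus one.
  tri<⇒<Q : ∀ {k n} → tri k < n → suc k < Q n
  tri<⇒<Q {k} {n} tri<n with Q-step (≤-trans (s≤s z≤n) tri<n)
  ... | m , x , eq , le = <-≤-trans (s≤s k<m) (m+n≤o⇒m≤o (suc m) le)
    where
    k<m : k < m
    k<m = ≰⇒> λ m≤k → <⇒≱ tri<n (≤-trans (m≤m+n n x) (≤-trans (≤-reflexive eq) (tri-mono m≤k)))

  -- Certified bounds from the table.

  module Tabulated (N : ℕ) (49≤N : 49 ≤ N) (t : Trie)
    (zero-ok : (tabP t 0 + tabQ t 0 ≤ᵇ 0) ≡ true) (lower-ok : lowerCheck N t ≡ true) (upper-ok : upperCheck N t ≡ true)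
    (slope-ok : slopeCheck N t ≡ true) (dominated-ok : dominatedCheck N t ≡ true) (isolated-ok : isolatedCheck N t ≡ true) where

    lP lQ : ℕ → ℕ
    lP = lowP N t
    lQ = lowQ N t

    lP-in : ∀ {x} → x < size N → lP x ≡ tabP t x
    lP-in {x} x< = cong (if_then tabP t x else suc N) (<ᵇ-true x<)

    lQ-in : ∀ {x} → x < size N → lQ x ≡ tabQ t x
    lQ-in {x} x< = cong (if_then tabQ t x else suc N) (<ᵇ-true x<)

    lP-out : ∀ {x} → size N ≤ x → lP x ≡ suc N
    lP-out {x} ≤x = cong (if_then tabP t x else suc N) (<ᵇ-false ≤x)

    lQ-out : ∀ {x} → size N ≤ x → lQ x ≡ suc N
    lQ-out {x} ≤x = cong (if_then tabQ t x else suc N) (<ᵇ-false ≤x)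

    LowStep : ℕ → ℕ → Set
    LowStep n m = lP n ≤ m + lQ (tri m ∸ n) × lQ n ≤ suc m + lP (tri m ∸ n) × (m ≤ n → lP n ≤ m + lP (n ∸ m))

    low-zero : lP 0 ≤ 0 × lQ 0 ≤ 0
    low-zero = ≤-trans (m≤m+n _ _) sum≤0 , ≤-trans (m≤n+m _ _) sum≤0
      where sum≤0 = ≤ᵇ⇒≤ (tabP t 0 + tabQ t 0) 0 (holds zero-ok)

    low-inside : ∀ {F G n} → tri F ≡ n + G → G < F → n < size N → ∀ {m} → F ≤ m → LowStep n m
    low-inside {F} {G} {n} eq G<F n< {m} F≤m =
        subst₂ (λ p q → p ≤ m + lQ (tri m ∸ n) × q ≤ suc m + lP (tri m ∸ n) × (m ≤ n → p ≤ m + lP (n ∸ m)))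
          (sym (lP-in n<)) (sym (lQ-in n<)) (scan-sound {R = R} stop→ ok→ (suc N) at F≤m)
      where
      R : ℕ → Set
      R m = tabP t n ≤ m + lQ (tri m ∸ n) × tabQ t n ≤ suc m + lP (tri m ∸ n) × (m ≤ n → tabP t n ≤ m + lP (n ∸ m))
      at : T (lowerAt N t F n)
      at = subst (λ x → T (lowerAt N t F x)) (row-∸ F G eq)
             (allBelow-sound F (allBelow-sound (suc N) (holds lower-ok) (s≤s (row-least eq G<F (s≤s⁻¹ n<)))) G<F)
      stop→ : ∀ {m k} → m ≤ k → T ((tabP t n ≤ᵇ m) ∧ (tabQ t n ≤ᵇ suc m)) → R k
      stop→ {m} {k} m≤k s with ∧-elim {tabP t n ≤ᵇ m} s
      ... | p , q = p≤ , ≤-trans (≤-trans (≤ᵇ⇒≤ (tabQ t n) (suc m) q) (s≤s m≤k)) (m≤m+n _ _) , λ _ → p≤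
        where
        p≤ : ∀ {y} → tabP t n ≤ k + y
        p≤ = ≤-trans (≤-trans (≤ᵇ⇒≤ (tabP t n) m p) m≤k) (m≤m+n _ _)
      ok→ : ∀ m → _ → R m
      ok→ m s with ∧-elim {tabP t n ≤ᵇ m + lQ (tri m ∸ n)} s
      ... | p , s′ with ∧-elim {tabQ t n ≤ᵇ suc m + lP (tri m ∸ n)} s′
      ...   | q , r = ≤ᵇ⇒≤ (tabP t n) _ p , ≤ᵇ⇒≤ (tabQ t n) _ q
                    , λ m≤n → [ (λ n<m → ⊥-elim (≤⇒≯ m≤n (<ᵇ⇒< n m n<m))) , ≤ᵇ⇒≤ (tabP t n) _ ]′ (∨-elim {n <ᵇ m} r)

    low-step : ∀ {n m} → n ≤ tri m → LowStep n m
    low-step {zero} _ = ≤-trans (proj₁ low-zero) z≤n , ≤-trans (proj₂ low-zero) z≤n , λ _ → ≤-trans (proj₁ low-zero) z≤n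
    low-step {n@(suc _)} {m} n≤tri with n <? size N
    ... | yes n< = low-inside (tri-f n) (g<f {n} (s≤s z≤n)) n< (f-least n≤tri)
    -- Outside the table `lP n` and `lQ n` are `suc N`, and `n ≤ tri m` already forces `m ≥ suc N`.
    ... | no  n≮ = ≤-trans lP≤m (m≤m+n m _) , ≤-trans (≤-trans lQ≤m (n≤1+n m)) (m≤m+n (suc m) _) , λ _ → ≤-trans lP≤m (m≤m+n m _)
      where
      N<m : suc N ≤ m
      N<m = ≰⇒> λ m≤N → <⇒≱ (≮⇒≥ n≮) (≤-trans n≤tri (tri-mono m≤N))
      lP≤m = ≤-trans (≤-reflexive (lP-out (≮⇒≥ n≮))) N<m
      lQ≤m = ≤-trans (≤-reflexive (lQ-out (≮⇒≥ n≮))) N<m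

    -- Induction on a bound for the elements: the gap and the set without its isolated maximum both
    -- have bound `top`, which is below `bound A`.
    low-sets : ∀ b A → bound A ≤ b → lP (vol A) ≤ per A × lQ (vol A) ≤ perCompl A
    low-sets b A A≤b with split? A
    ... | inj₁ v≡0 = subst (λ v → lP v ≤ per A × lQ v ≤ perCompl A) (sym v≡0) (≤-trans (proj₁ low-zero) z≤n , ≤-trans (proj₂ low-zero) z≤n)
    low-sets zero A A≤b | inj₂ s = ⊥-elim (n≮0 (<-≤-trans (TopSplit.top< s) A≤b))
    low-sets (suc b) A A≤b | inj₂ s = p-bound (per-split s) , (begin
      lQ (vol A)                              ≤⟨ proj₁ (proj₂ steps) ⟩
      suc (top s) + lP (tri (top s) ∸ vol A)  ≡⟨ cong (λ v → suc (top s) + lP v) gap-vol ⟩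
      suc (top s) + lP (vol (gap s))          ≤⟨ +-monoʳ-≤ (suc (top s)) (proj₁ (low-sets b (gap s) gap≤b)) ⟩
      suc (top s) + per (gap s)               ≡⟨ perCompl-split s ⟨
      perCompl A                              ∎)
      where
      open TopSplit
      open ≤-Reasoning
      top≤b : top s ≤ b
      top≤b = s≤s⁻¹ (<-≤-trans (top< s) A≤b)
      gap≤b : bound (gap s) ≤ b
      gap≤b = ≤-trans (≤-reflexive (gap-bound s)) top≤b
      gap-vol : tri (top s) ∸ vol A ≡ vol (gap s)
      gap-vol = trans (cong (_∸ vol A) (sym (vol-gap s))) (m+n∸m≡n (vol A) _)
      steps : LowStep (vol A) (top s)
      steps = low-step (≤-trans (m≤m+n _ _) (≤-reflexive (vol-gap s)))
      p-bound : per A ≡ top s + perCompl (gap s)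
              ⊎ (Σ FinSub λ A′ → bound A′ ≡ top s × vol A ≡ top s + vol A′ × per A ≡ top s + per A′) →
                lP (vol A) ≤ per A
      p-bound (inj₁ p≡) = begin
        lP (vol A)                          ≤⟨ proj₁ steps ⟩
        top s + lQ (tri (top s) ∸ vol A)    ≡⟨ cong (λ v → top s + lQ v) gap-vol ⟩
        top s + lQ (vol (gap s))            ≤⟨ +-monoʳ-≤ (top s) (proj₂ (low-sets b (gap s) gap≤b)) ⟩
        top s + perCompl (gap s)            ≡⟨ p≡ ⟨
        per A                               ∎
      p-bound (inj₂ (A′ , b≡ , v≡ , p≡)) = begin
        lP (vol A)                          ≤⟨ proj₂ (proj₂ steps) (≤-trans (m≤m+n (top s) _) (≤-reflexive (sym v≡))) ⟩
        top s + lP (vol A ∸ top s)          ≡⟨ cong (λ v → top s + lP v) (trans (cong (_∸ top s) v≡) (m+n∸m≡n (top s) _)) ⟩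
        top s + lP (vol A′)                 ≤⟨ +-monoʳ-≤ (top s) (proj₁ (low-sets b A′ (≤-trans (≤-reflexive b≡) top≤b))) ⟩
        top s + per A′                      ≡⟨ p≡ ⟨
        per A                               ∎

    lP≤P : ∀ n → lP n ≤ P n
    lP≤P n with isP n
    ... | (A , v≡ , p≡) , _ = subst₂ (λ v p → lP v ≤ p) v≡ p≡ (proj₁ (low-sets (bound A) A ≤-refl))

    lQ≤Q : ∀ n → lQ n ≤ Q n
    lQ≤Q n with isQ n
    ... | (A , v≡ , q≡) , _ = subst₂ (λ v q → lQ v ≤ q) v≡ q≡ (proj₂ (low-sets (bound A) A ≤-refl))

    witnessP-sound : ∀ n v → T (any (witnessP n v) exceptions) → P n ≤ v
    witnessP-sound n v w with satisfied (any⁻ (witnessP n v) exceptions w)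
    ... | (k , a , b) , ok with ∧-elim {vol (runs a) ≡ᵇ n} (proj₂ (∧-elim {n ≡ᵇ k} ok))
    ... | v≡ , p≤ = subst (λ x → P x ≤ v) (≡ᵇ⇒≡ (vol (runs a)) n v≡) (≤-trans (P-≤ (runs a)) (≤ᵇ⇒≤ (per (runs a)) v p≤))

    witnessQ-sound : ∀ n v → T (any (witnessQ n v) exceptions) → Q n ≤ v
    witnessQ-sound n v w with satisfied (any⁻ (witnessQ n v) exceptions w)
    ... | (k , a , b) , ok with ∧-elim {vol (runs b) ≡ᵇ n} (proj₂ (∧-elim {n ≡ᵇ k} ok))
    ... | v≡ , q≤ = subst (λ x → Q x ≤ v) (≡ᵇ⇒≡ (vol (runs b)) n v≡) (≤-trans (Q-≤ (runs b)) (≤ᵇ⇒≤ (perCompl (runs b)) v q≤))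

    Bounded : ℕ → Set
    Bounded n = n < size N → P n ≤ tabP t n × Q n ≤ tabQ t n

    tab-upper-row : ∀ {F G n} → tri F ≡ n + G → G < F → Bounded G → Bounded n
    tab-upper-row {F} {G} {n} eq G<F ih n< =
        [ recP , witnessP-sound n (tabP t n) ]′ (∨-elim {F + tabQ t G ≤ᵇ tabP t n} (proj₁ at))
      , [ recQ , witnessQ-sound n (tabQ t n) ]′ (∨-elim {suc F + tabP t G ≤ᵇ tabQ t n} (proj₂ at))
      where
      G< : G < size N
      G< = <-trans (row-< eq G<F) n<
      at = ∧-elim {(F + tabQ t G ≤ᵇ tabP t n) ∨ any (witnessP n (tabP t n)) exceptions}
             (subst (λ x → T (upperAt t F G x)) (row-∸ F G eq)
               (allBelow-sound F (allBelow-sound (suc N) (holds upper-ok) (s≤s (row-least eq G<F (s≤s⁻¹ n<)))) G<F))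
      recP : T (F + tabQ t G ≤ᵇ tabP t n) → P n ≤ tabP t n
      recP le = ≤-trans (proj₁ (complement-upper eq G<F)) (≤-trans (+-monoʳ-≤ F (proj₂ (ih G<))) (≤ᵇ⇒≤ _ _ le))
      recQ : T (suc F + tabP t G ≤ᵇ tabQ t n) → Q n ≤ tabQ t n
      recQ le = ≤-trans (proj₂ (complement-upper eq G<F)) (≤-trans (+-monoʳ-≤ (suc F) (proj₁ (ih G<))) (≤ᵇ⇒≤ _ _ le))

    tab-upper : ∀ n → Bounded n
    tab-upper = rows-rec Bounded (λ _ → ≤-trans (P-≤ (runs [])) z≤n , ≤-trans (Q-≤ (runs [])) z≤n) tab-upper-row

    -- Linear upper bounds for `P` and `Q`.

    Slope : ℕ → Set
    Slope y = 4 * P y ≤ 32 + y × 4 * Q y ≤ 32 + y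

    slope-small : ∀ {y} → y < size N → Slope y
    slope-small {y} y< with ∧-elim {4 * tabP t y ≤ᵇ 32 + y} (allBelow-sound (size N) (holds slope-ok) y<)
    ... | p , q = ≤-trans (*-monoʳ-≤ 4 (proj₁ (tab-upper y y<))) (≤ᵇ⇒≤ (4 * tabP t y) _ p)
                , ≤-trans (*-monoʳ-≤ 4 (proj₂ (tab-upper y y<))) (≤ᵇ⇒≤ (4 * tabQ t y) _ q)

    four-times : ∀ {F G y} → tri F ≡ y + G → G < F → Slope G →
                 4 * P y ≤ 32 + (4 * suc F + G) × 4 * Q y ≤ 32 + (4 * suc F + G)
    four-times {F} {G} eq G<F (p≤ , q≤) with complement-upper eq G<F
    ... | P≤ , Q≤ = quadruple (≤-trans P≤ (+-monoˡ-≤ _ (n≤1+n F))) q≤ , quadruple Q≤ p≤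
      where
      quadruple : ∀ {v w} → v ≤ suc F + w → 4 * w ≤ 32 + G → 4 * v ≤ 32 + (4 * suc F + G)
      quadruple {v} {w} v≤ w≤ = begin
        4 * v                       ≤⟨ *-monoʳ-≤ 4 v≤ ⟩
        4 * (suc F + w)             ≡⟨ *-distribˡ-+ 4 (suc F) w ⟩
        4 * suc F + 4 * w           ≤⟨ +-monoʳ-≤ (4 * suc F) w≤ ⟩
        4 * suc F + (32 + G)        ≡⟨ swap (4 * suc F) G ⟩
        32 + (4 * suc F + G)        ∎
        where
        open ≤-Reasoning
        swap : ∀ a b → a + (32 + b) ≡ 32 + (a + b)
        swap = solve-∀

    slope-row : ∀ {F G y} → tri F ≡ y + G → G < F → Slope G → Slope y
    slope-row {F} {G} {y} eq G<F ih with y <? size N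
    ... | yes y< = slope-small y<
    ... | no  y≮ = ≤-trans (proj₁ bounds) small , ≤-trans (proj₂ bounds) small
      where
      bounds = four-times eq G<F ih
      12≤F : 12 ≤ F
      12≤F = ≤-trans (m≤m+n 12 37) (≤-trans 49≤N (<⇒≤ (row-large eq (≮⇒≥ y≮))))
      small : 32 + (4 * suc F + G) ≤ 32 + y
      small = +-monoʳ-≤ 32 (rec-slope 12≤F G<F eq)

    slope : ∀ y → Slope y
    slope = rows-rec Slope (slope-small (s≤s z≤n)) slope-row

    -- Competitors with a larger maximum.

    Dominated : ℕ → ℕ → ℕ → Set
    Dominated G j x = P G ≤ j + P x × Q G ≤ j + Q x

    -- `u - j - 1 < P x` gives `u ≤ j + P x`; the bound for `Q` is better by one, which absorbs the
    -- `suc u`. Larger volumes and larger `j` only help.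
    dominated-far : ∀ {G u j k x y} → P G ≤ u → Q G ≤ suc u → tri (u ∸ suc j) < x → x ≤ y → j ≤ k → Dominated G k y
    dominated-far {G} {u} {j} {k} {x} {y} P≤u Q≤1+u tri<x x≤y j≤k =
        ≤-trans P≤u (≤-trans u≤ (+-mono-≤ j≤k (tri<⇒<P (<-≤-trans tri<x x≤y))))
      , ≤-trans Q≤1+u (≤-trans (s≤s u≤) (≤-trans (≤-reflexive (sym (+-suc j _))) (+-mono-≤ j≤k (tri<⇒<Q (<-≤-trans tri<x x≤y)))))
      where
      u≤ : u ≤ j + suc (u ∸ suc j)
      u≤ = ≤-trans (m≤n+m∸n u (suc j)) (≤-reflexive (sym (+-suc j _)))

    dominated-small : ∀ {F G} → G < size N → G < F → ¬ (tri F ∸ G ∈ E) → ∀ j → 1 ≤ j → Dominated G j (excess F G j)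
    dominated-small {F} {G} G< G<F n∉E j 1≤j =
      [ (λ good → good j 1≤j) , (λ n∈E → ⊥-elim (n∉E n∈E)) ]′
        (scan-sound {R = R} stop→ ok→ (size N) (allBelow-sound (size N) (holds dominated-ok) G<) G<F)
      where
      u = tabP t G ⊔ (tabQ t G ∸ 1)
      P≤u : P G ≤ u
      P≤u = ≤-trans (proj₁ (tab-upper G G<)) (m≤m⊔n _ _)
      Q≤1+u : Q G ≤ suc u
      Q≤1+u = ≤-trans (proj₂ (tab-upper G G<)) (≤-trans (m≤n+m∸n (tabQ t G) 1) (s≤s (m≤n⊔m (tabP t G) _)))
      R : ℕ → Set
      R F = (∀ j → 1 ≤ j → Dominated G j (excess F G j)) ⊎ tri F ∸ G ∈ E
      -- `excess F G 1`, which is `suc F + G`, is the smallest volume met in any later row with any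
      -- `j ≥ 1`.
      stop→ : ∀ {F F′} → F ≤ F′ → T (beyond u F G 1) → R F′
      stop→ {F} {F′} F≤F′ b = inj₁ λ j 1≤j → dominated-far P≤u Q≤1+u (<ᵇ⇒< (tri (u ∸ 2)) _ b) (excess≤ j 1≤j) 1≤j
        where
        open ≤-Reasoning
        excess≤ : ∀ j → 1 ≤ j → excess F G 1 ≤ excess F′ G j
        excess≤ j 1≤j = begin
          excess F G 1   ≡⟨ excess-one F G ⟩
          suc F + G      ≤⟨ +-monoˡ-≤ G (s≤s F≤F′) ⟩
          suc F′ + G     ≡⟨ excess-one F′ G ⟨
          excess F′ G 1  ≤⟨ excess-mono F′ G 1≤j ⟩
          excess F′ G j  ∎
      ok→ : ∀ F → T (dominatedCheckAt N t u G F) → R F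
      ok→ F c with ∨-elim {scan (beyond u F G) _ (suc N) 1} c
      ... | inj₂ e = inj₂ (elem-sound (tri F ∸ G) E e)
      ... | inj₁ s = inj₁ λ j → scan-sound {R = λ j → Dominated G j (excess F G j)}
          (λ {j} {k} j≤k b → dominated-far P≤u Q≤1+u (<ᵇ⇒< (tri (u ∸ suc j)) _ b) (excess-mono F G j≤k) j≤k)
          (λ j d → let p , q = ∧-elim {tabP t G ≤ᵇ j + lP (excess F G j)} d in
              ≤-trans (proj₁ (tab-upper G G<)) (≤-trans (≤ᵇ⇒≤ (tabP t G) _ p) (+-monoʳ-≤ j (lP≤P _)))
            , ≤-trans (proj₂ (tab-upper G G<)) (≤-trans (≤ᵇ⇒≤ (tabQ t G) _ q) (+-monoʳ-≤ j (lQ≤Q _))))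
          (suc N) s

    -- `F > G` makes every volume to be compared at least `2G + 2`, where `slope-beaten` applies;
    -- hence no exceptions arise here.
    dominated-large : ∀ {F G k h} → tri k ≡ G + h → h < k → size N ≤ G → G < F → ∀ j → 1 ≤ j → Dominated G j (excess F G j)
    dominated-large {F} {G} {k} {h} eq h<k ≤G G<F j 1≤j =
      dominated-far (m≤m⊔n (P G) (Q G ∸ 1)) (≤-trans (m≤n+m∸n (Q G) 1) (s≤s (m≤n⊔m (P G) _)))
        (slope-beaten {u = u} (≤-trans (s≤s 49≤N) (row-large eq ≤G)) h<k eq 4u≤) excess≥ 1≤j
      where
      open ≤-Reasoning
      u = P G ⊔ (Q G ∸ 1)
      bounds = four-times eq h<k (slope h)
      excess≥ : suc (suc (G + G)) ≤ excess F G j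
      excess≥ = begin
        suc (suc G) + G  ≤⟨ +-monoˡ-≤ G (s≤s G<F) ⟩
        suc F + G        ≡⟨ excess-one F G ⟨
        excess F G 1     ≤⟨ excess-mono F G 1≤j ⟩
        excess F G j     ∎
      4u≤ : 4 * u ≤ 35 + 5 * k
      4u≤ = begin
        4 * u                         ≤⟨ *-monoʳ-≤ 4 (⊔-monoʳ-≤ (P G) (m∸n≤m (Q G) 1)) ⟩
        4 * (P G ⊔ Q G)               ≡⟨ *-distribˡ-⊔ 4 (P G) (Q G) ⟩
        4 * P G ⊔ 4 * Q G             ≤⟨ ⊔-lub (proj₁ bounds) (proj₂ bounds) ⟩
        32 + (4 * suc k + h)          ≡⟨ regroup k h ⟩
        4 * k + 35 + suc h            ≤⟨ +-monoʳ-≤ (4 * k + 35) h<k ⟩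
        4 * k + 35 + k                ≡⟨ regroup′ k ⟩
        35 + 5 * k                    ∎
        where
        regroup : ∀ a b → 32 + (4 * suc a + b) ≡ 4 * a + 35 + suc b
        regroup = solve-∀
        regroup′ : ∀ a → 4 * a + 35 + a ≡ 35 + 5 * a
        regroup′ = solve-∀

    dominated : ∀ {F G} → G < F → ¬ (tri F ∸ G ∈ E) → ∀ j → 1 ≤ j → Dominated G j (excess F G j)
    dominated {F} {G} G<F n∉E with G <? size N
    ... | yes G< = dominated-small G< G<F n∉E
    ... | no  G≮ = dominated-large (tri-f G) (g<f {G} (≤-trans (s≤s z≤n) (≮⇒≥ G≮))) (≮⇒≥ G≮) G<F

    -- Competitors with an isolated maximum.

    isolated-small : ∀ {F G} → F < 16 → G < F → ¬ (tri F ∸ G ∈ E) → ∀ {j x} → x + (j + F + G) ≡ tri F → Q G ≤ j + P x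
    isolated-small {F} {G} F<16 G<F n∉E {j} {x} eq =
      [ within , (λ e → ⊥-elim (n∉E (elem-sound (tri F ∸ G) E e))) ]′
        (∨-elim {allBelow (tabQ t G) ok}
          (allBelow-sound F (allBelow-sound 16 {λ F → allBelow F (isolatedCheckAt N t F)} (holds isolated-ok) F<16) G<F))
      where
      Q≤ : Q G ≤ tabQ t G
      Q≤ = proj₂ (tab-upper G (<-≤-trans (<-trans G<F F<16)
             (≤-trans (m≤m+n 16 33) (≤-trans 49≤N (≤-trans (k≤tri N) (n≤1+n (tri N)))))))
      rest : tri F ∸ (j + F + G) ≡ x
      rest = trans (cong (_∸ (j + F + G)) (sym eq)) (m+n∸n≡m x (j + F + G))
      ok : ℕ → Bool
      ok j = (tri F <ᵇ j + F + G) ∨ (tabQ t G ≤ᵇ j + lP (tri F ∸ (j + F + G)))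
      within : T (allBelow (tabQ t G) ok) → Q G ≤ j + P x
      within a with j <? tabQ t G
      ... | no  j≮ = ≤-trans Q≤ (≤-trans (≮⇒≥ j≮) (m≤m+n j _))
      ... | yes j< with ∨-elim {tri F <ᵇ j + F + G} (allBelow-sound (tabQ t G) {ok} a j<)
      ...   | inj₁ l = ⊥-elim (<⇒≱ (<ᵇ⇒< (tri F) _ l) (≤-trans (m≤n+m _ x) (≤-reflexive eq)))
      ...   | inj₂ c = begin
        Q G                            ≤⟨ Q≤ ⟩
        tabQ t G                       ≤⟨ ≤ᵇ⇒≤ (tabQ t G) _ c ⟩
        j + lP (tri F ∸ (j + F + G))   ≤⟨ +-monoʳ-≤ j (lP≤P _) ⟩
        j + P (tri F ∸ (j + F + G))    ≡⟨ cong (λ y → j + P y) rest ⟩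
        j + P x                        ∎
        where open ≤-Reasoning

    -- Write `F = e + 4`. The slope bound gives `Q G ≤ e + 1`. So either `j` alone suffices, or
    -- `j ≤ e + 1` and the remaining volume `x` exceeds `tri e`, whence `P x ≥ e + 1`.
    isolated-large : ∀ {F G} → 16 ≤ F → G < F → ∀ {j x} → x + (j + F + G) ≡ tri F → Q G ≤ j + P x
    isolated-large {F@(suc (suc (suc (suc e))))} {G} (s≤s (s≤s (s≤s (s≤s 12≤e)))) G<F {j} {x} eq with Q G ≤? j
    ... | yes Q≤j = ≤-trans Q≤j (m≤m+n j _)
    ... | no  Q≰j = ≤-trans (≤-trans Q≤ (tri<⇒<P tri<x)) (m≤n+m _ j)
      where
      open ≤-Reasoning
      Q≤ : Q G ≤ suc e
      Q≤ = s≤s⁻¹ (*-cancelˡ-< 4 _ _ (begin-strict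
        4 * Q G                ≤⟨ proj₂ (slope G) ⟩
        32 + G                 <⟨ +-monoʳ-< 32 G<F ⟩
        28 + (8 + e)           ≤⟨ +-monoˡ-≤ (8 + e) (≤-trans (m≤m+n 28 8) (*-monoʳ-≤ 3 12≤e)) ⟩
        3 * e + (8 + e)        ≡⟨ regroup e ⟩
        4 * suc (suc e)        ∎))
        where
        regroup : ∀ e → 3 * e + (8 + e) ≡ 4 * suc (suc e)
        regroup = solve-∀
      tri<x : tri e < x
      tri<x = +-cancelʳ-< (j + F + G) _ _ (begin-strict
        tri e + (j + F + G)                        ≤⟨ +-monoʳ-≤ (tri e) (+-mono-≤ (+-monoˡ-≤ F (≤-trans (<⇒≤ (≰⇒> Q≰j)) Q≤)) (s≤s⁻¹ G<F)) ⟩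
        -- The bounds on `j` and `G` use up the summands `e + 1` and `e + 3` of `tri F`; the summand
        -- `e + 2` remains as slack.
        tri e + (suc e + F + (3 + e))              <⟨ m<m+n _ (s≤s z≤n) ⟩
        tri e + (suc e + F + (3 + e)) + suc (suc e) ≡⟨ regroup (tri e) e ⟩
        tri e + suc e + (2 + e) + (3 + e) + F      ≡⟨ tri-4+ e ⟨
        tri F                                      ≡⟨ eq ⟨
        x + (j + F + G)                            ∎)
        where
        regroup : ∀ t e → t + (suc e + (4 + e) + (3 + e)) + suc (suc e) ≡ t + suc e + (2 + e) + (3 + e) + (4 + e)
        regroup = solve-∀

    isolated : ∀ {F G} → G < F → ¬ (tri F ∸ G ∈ E) → ∀ {j x} → x + (j + F + G) ≡ tri F → Q G ≤ j + P x
    isolated {F} G<F n∉E with F <? 16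
    ... | yes F< = isolated-small F< G<F n∉E
    ... | no  F≮ = isolated-large (≮⇒≥ F≮) G<F

    -- The recursion.

    module _ {F G n} (eq : tri F ≡ n + G) (G<F : G < F) (n∉E : ¬ (n ∈ E)) where
      private
        1≤n : 1 ≤ n
        1≤n = ≤-trans (s≤s z≤n) (row-pred eq G<F)
        ∉E : ¬ (tri F ∸ G ∈ E)
        ∉E = subst (λ x → ¬ (x ∈ E)) (sym (row-∸ F G eq)) n∉E

        excess-unique : ∀ j {x} → n + x ≡ tri (F + j) → excess F G j ≡ x
        excess-unique j {x} sum = +-cancelˡ-≡ n _ _ (begin
          n + excess F G j                ≡⟨ cong (n +_) (+-comm (tri (F + j) ∸ tri F) G) ⟩
          n + (G + (tri (F + j) ∸ tri F)) ≡⟨ +-assoc n G _ ⟨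
          n + G + (tri (F + j) ∸ tri F)   ≡⟨ cong (_+ (tri (F + j) ∸ tri F)) eq ⟨
          tri F + (tri (F + j) ∸ tri F)   ≡⟨ m+[n∸m]≡n (tri-mono (m≤m+n F j)) ⟩
          tri (F + j)                     ≡⟨ sum ⟨
          n + x                           ∎)
          where open ≡-Reasoning

        -- For `j = 0` the gap has volume exactly `G` and both inequalities are equalities.
        gap-dominated : ∀ j {x} → n + x ≡ tri (F + j) → Dominated G j x
        gap-dominated zero {x} sum = ≤-reflexive (cong P G≡x) , ≤-reflexive (cong Q G≡x)
          where
          G≡x : G ≡ x
          G≡x = +-cancelˡ-≡ n G x (trans (sym eq) (trans (cong tri (sym (+-identityʳ F))) (sym sum)))
        gap-dominated j@(suc _) sum = subst (Dominated G j) (excess-unique j sum) (dominated G<F ∉E j (s≤s z≤n))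

        P-lower : F + Q G ≤ P n
        P-lower with P-step 1≤n
        -- `F` is the least index whose `tri` reaches `n`, so the maximum can be written `F + j`.
        ... | m , n≤tri , choice with m≤n⇒∃[o]m+o≡n (row-least {m = m} eq G<F n≤tri)
        ... | j , refl with choice
        ...   | inj₁ (x , sum , le) = begin
          F + Q G        ≤⟨ +-monoʳ-≤ F (proj₂ (gap-dominated j sum)) ⟩
          F + (j + Q x)  ≡⟨ +-assoc F j (Q x) ⟨
          F + j + Q x    ≤⟨ le ⟩
          P n            ∎
          where open ≤-Reasoning
        ...   | inj₂ (x , sum , le) = begin
          F + Q G        ≤⟨ +-monoʳ-≤ F (isolated G<F ∉E {j} {x} total) ⟩
          F + (j + P x)  ≡⟨ +-assoc F j (P x) ⟨
          F + j + P x    ≤⟨ le ⟩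
          P n            ∎
          where
          open ≤-Reasoning
          regroup : ∀ x j F G → x + (j + F + G) ≡ F + j + x + G
          regroup = solve-∀
          total : x + (j + F + G) ≡ tri F
          total = trans (regroup x j F G) (trans (cong (_+ G) (sym sum)) (sym eq))

        Q-lower : suc F + P G ≤ Q n
        Q-lower with Q-step 1≤n
        ... | m , x , sum , le with m≤n⇒∃[o]m+o≡n (row-least {m = m} eq G<F (≤-trans (m≤m+n n x) (≤-reflexive sum)))
        ... | j , refl = begin
          suc F + P G        ≤⟨ +-monoʳ-≤ (suc F) (proj₁ (gap-dominated j sum)) ⟩
          suc F + (j + P x)  ≡⟨ +-assoc (suc F) j (P x) ⟨
          suc F + j + P x    ≤⟨ le ⟩
          Q n                ∎
          where open ≤-Reasoning

      recursion-row : Σ ℕ (λ q → IsQ G q × IsP n (F + q)) × Σ ℕ (λ p → IsP G p × IsQ n (suc (F + p)))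
      recursion-row = (Q G , isQ G , subst (IsP n) (≤-antisym (proj₁ (complement-upper eq G<F)) P-lower) (isP n))
                    , (P G , isP G , subst (IsQ n) (≤-antisym (proj₂ (complement-upper eq G<F)) Q-lower) (isQ n))

    recursion : ∀ n → ¬ (n ∈ E) →
                Σ ℕ (λ q → IsQ (g n) q × IsP n (f n + q)) × Σ ℕ (λ p → IsP (g n) p × IsQ n (suc (f n + p)))
    -- `0` heads `E`, so `n ∉ E` excludes `n = 0`, where `g<f` would fail.
    recursion n n∉E = recursion-row (tri-f n) (g<f {n} (n≢0⇒n>0 λ n≡0 → n∉E (here n≡0))) n∉E

-- Existence of the minima and evaluation of the tests.

isMinimum : (φ : FinSub → ℕ) → (∀ A B → A ≐ B → φ A ≡ φ B) → ∀ n →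
            Σ ℕ λ m → Σ FinSub (λ A → vol A ≡ n × φ A ≡ m) × (∀ A → vol A ≡ n → m ≤ φ A)
isMinimum φ φ-cong n with minimiser φ φ-cong n
... | A , v≡ , least = φ A , (A , v≡ , refl) , least


table : Trie
-- Depth `11` leaves room for `2 ^ 11 = 2048` entries, and `size 49` is `1226`.
table = fromList 11 (rows 49)

zero-checked : (tabP table 0 + tabQ table 0 ≤ᵇ 0) ≡ true
zero-checked = refl

lower-checked : lowerCheck 49 table ≡ true
lower-checked = refl

upper-checked : upperCheck 49 table ≡ true
upper-checked = refl

slope-checked : slopeCheck 49 table ≡ true
slope-checked = refl

dominated-checked : dominatedCheck 49 table ≡ true
dominated-checked = refl

isolated-checked : isolatedCheck 49 table ≡ true
isolated-checked = refl

theorem18 : ((n : ℕ) → ¬ (n ∈ E) →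
    Σ ℕ (λ q → IsQ (g n) q × IsP n (f n + q))
    × Σ ℕ (λ p → IsP (g n) p × IsQ n (suc (f n + p))))
    × ((n : ℕ) → tri (f n) ≡ n + g n
    × ((k h : ℕ) → tri k ≡ n + h → f n ≤ k × g n ≤ h))
theorem18 = Tabulated.recursion 49 ≤-refl table
              zero-checked lower-checked upper-checked slope-checked dominated-checked isolated-checked
          , λ n → tri-f n , λ k h eq → f-least {k = k} (≤-trans (m≤m+n n h) (≤-reflexive (sym eq))) , g-least n {k} eq
  where
  open Minima (λ n → proj₁ (isMinimum per per-cong n)) (λ n → proj₁ (isMinimum perCompl perCompl-cong n))
              (λ n → proj₂ (isMinimum per per-cong n)) (λ n → proj₂ (isMinimum perCompl perCompl-cong n))
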